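{- Let $P_1$ and $P_2$ be lower-L-bounded posets with $\hat 0$. Let $d(P_2)$ be the dual of $P_2$. Then the poset $P$ obtained by identifying the $\hat 0$ of $P_1$ with the $\hat 1$ of $d(P_2)$ satisfies $\pi(P)=e(P)$; that is, the limit $\pi(P)=\lim_{n\to\infty}\mathrm{La}(n,P)/\binom{n}{\lfloor n/2\rfloor}$ exists and equals $e(P)$.
   Context: All posets are finite and nonempty. Let $[n]=\{1,\dots,n\}$; families of subsets of $[n]$ are ordered by inclusion. A poset $(P,\le)$ contains a poset $(P',\le')$ as a (weak) subposet if there is an injection $f:P'\to P$ such that $u\le' v$ implies $f(u)\le f(v)$. A family $\mathcal F\subseteq 2^{[n]}$ is $P$-free if it does not contain $P$ in this sense. $\mathrm{La}(n,P)$ is the largest size of a $P$-free family $\mathcal F\subseteq 2^{[n]}$. $e(P)$ is the maximum integer $k\ge 0$ such that for all integers $n$ and $s$ the family $\binom{[n]}{s}\cup\binom{[n]}{s+1}\cup\cdots\cup\binom{[n]}{s+k-1}$ is $P$-free, where $\binom{[n]}{j}$ is the collection of $j$-element subsets of $[n]$ (empty if $j<0$ or $j>n$). The Lubell function of $\mathcal F\subseteq 2^{[n]}$ is the average over all $n!$ full (maximal) chains $\mathcal C$ of $2^{[n]}$ of $|\mathcal F\cap\mathcal C|$; equivalently $\bar h_n(\mathcal F)=\sum_{F\in\mathcal F}1/\binom{n}{|F|}$. $P$ is lower-L-bounded if for any $\beta\in(\frac12,1)$ and $\varepsilon>0$ there exists $N=N(\beta,\varepsilon)$ such that for all $n\ge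 N$, $\bar h_n(\mathcal F)\le e(P)+\varepsilon$ for all $P$-free families $\mathcal F$ of subsets of $[n]$ of sizes less than $\beta n$. An element $x$ of a poset $P$ is $\hat 0$ (resp. $\hat 1$) if $x\le p$ (resp. $x\ge p$) for all $p\in P$. The dual $d(P)$ of $P$ is the same set with the order reversed; the $\hat 0$ of $P_2$ is the $\hat 1$ of $d(P_2)$. The poset obtained by the identification is the disjoint union of $P_1$ and $d(P_2)$ with the two elements identified, ordered by the transitive closure of the union of the two orders (so every element of $d(P_2)$ lies below every element of $P_1$). -}

module Defs where

open import Data.Fin.Subset using (Subset; ∣_∣)
open import Data.Fin.Subset.Properties using (⊆-poset; ∣p∣≤n)
open import Data.Integer.Base as ℤ using (ℤ; +_)
open import Data.List.Base using (List; length; map; foldr; _++_)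
open import Data.List.Membership.Propositional using (_∈_)
import Data.List.Membership.Setoid.Properties as ∈ₛ
import Data.List.Relation.Unary.Enumerates.Setoid as Enum
open import Data.List.Relation.Unary.Unique.Propositional using (Unique)
open import Data.Nat.Base using (ℕ; zero; suc; NonZero; ⌊_/2⌋; z≤n; s≤s)
  renaming (_≤_ to _≤ℕ_; _+_ to _+ℕ_)
open import Data.Nat.Combinatorics using (_C_; nCk+nC[k+1]≡[n+1]C[k+1])
open import Data.Nat.Properties using (⌊n/2⌋≤n)
open import Data.Product using (Σ-syntax; ∃-syntax; _×_; _,_; proj₁)
open import Data.Rational.Base using (ℚ; 0ℚ; 1ℚ; ½; _/_; _+_; _-_; _*_; _<_; _≤_) renaming (∣_∣ to ∣_∣ℚ)
open import Data.Sum.Base using (_⊎_; inj₁; inj₂)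
open import Function.Base using (flip)
open import Function.Definitions using (Injective)
open import Level using (0ℓ)
open import Relation.Binary.Bundles using (Poset; DecPoset)
open import Relation.Binary.Core using (Rel; _Preserves_⟶_)
open import Relation.Binary.Definitions using (Minimum; Maximum; Decidable)
open import Relation.Binary.Structures using (IsEquivalence; IsPartialOrder)
open import Relation.Binary.Construct.Closure.Transitive using (TransClosure; [_]; _∷_)
  renaming (_++_ to _++⁺_)
import Relation.Binary.Construct.Flip.EqAndOrd as Flip
import Relation.Binary.Construct.On as On
open import Relation.Binary.PropositionalEquality using (_≡_; subst)
open import Relation.Nullary using (¬_; yes; no)
open import Relation.Nullary.Decidable using (map′; _×-dec_)
open import Relation.Unary using (Pred)

------------------------------------------------------------------------
-- Finite nonempty posets

-- The carrier is a setoid, so that two elements can be identified without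
-- forming a quotient type.  Finite: equality and order are decidable (as
-- they always are classically) and a list contains every element up to _≈_.
record FinitePoset : Set₁ where
  field
    decPoset   : DecPoset 0ℓ 0ℓ 0ℓ
  open DecPoset decPoset public
  field
    elements   : List Carrier
    enumerates : Enum.IsEnumeration Eq.setoid elements
    nonempty   : Carrier

dual : FinitePoset → FinitePoset
dual P = record
  { decPoset   = record
    { isDecPartialOrder = record
      { isPartialOrder = Flip.isPartialOrder isPartialOrder
      ; _≟_            = _≟_
      ; _≤?_           = flip _≤?_
      }
    }
  ; elements   = elements
  ; enumerates = enumerates
  ; nonempty   = nonempty
  }
  where open FinitePoset P

------------------------------------------------------------------------
-- Disjoint union of P and Q, with the least element b of P identified
-- with the greatest element t of Q

module Glue (P Q : FinitePoset)
            {b : FinitePoset.Carrier P} (b-min : Minimum (FinitePoset._≤_ P) b)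
            {t : FinitePoset.Carrier Q} (t-max : Maximum (FinitePoset._≤_ Q) t) where

  private
    module P = FinitePoset P
    module Q = FinitePoset Q

  Carrier : Set
  Carrier = P.Carrier ⊎ Q.Carrier

  data _≈_ : Rel Carrier 0ℓ where
    P≈  : ∀ {x x′} → x P.≈ x′ → inj₁ x ≈ inj₁ x′
    Q≈  : ∀ {y y′} → y Q.≈ y′ → inj₂ y ≈ inj₂ y′
    b≈t : ∀ {x y} → x P.≈ b → y Q.≈ t → inj₁ x ≈ inj₂ y
    t≈b : ∀ {x y} → x P.≈ b → y Q.≈ t → inj₂ y ≈ inj₁ x

  data _⊑_ : Rel Carrier 0ℓ where
    P≤ : ∀ {x x′} → x P.≤ x′ → inj₁ x ⊑ inj₁ x′
    Q≤ : ∀ {y y′} → y Q.≤ y′ → inj₂ y ⊑ inj₂ y′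
    ≈⊑ : ∀ {u v} → u ≈ v → u ⊑ v

  _≤ᵍ_ : Rel Carrier 0ℓ
  _≤ᵍ_ = TransClosure _⊑_

  ≈-isEquivalence : IsEquivalence _≈_
  ≈-isEquivalence = record { refl = refl ; sym = sym ; trans = trans }
    where
    refl : ∀ {u} → u ≈ u
    refl {inj₁ _} = P≈ P.Eq.refl
    refl {inj₂ _} = Q≈ Q.Eq.refl
    sym : ∀ {u v} → u ≈ v → v ≈ u
    sym (P≈ p)    = P≈ (P.Eq.sym p)
    sym (Q≈ q)    = Q≈ (Q.Eq.sym q)
    sym (b≈t p q) = t≈b p q
    sym (t≈b p q) = b≈t p q
    trans : ∀ {u v w} → u ≈ v → v ≈ w → u ≈ w
    trans (P≈ p)    (P≈ p′)     = P≈ (P.Eq.trans p p′)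
    trans (P≈ p)    (b≈t p′ q)  = b≈t (P.Eq.trans p p′) q
    trans (Q≈ q)    (Q≈ q′)     = Q≈ (Q.Eq.trans q q′)
    trans (Q≈ q)    (t≈b p q′)  = t≈b p (Q.Eq.trans q q′)
    trans (b≈t p q) (Q≈ q′)     = b≈t p (Q.Eq.trans (Q.Eq.sym q′) q)
    trans (b≈t p q) (t≈b p′ q′) = P≈ (P.Eq.trans p (P.Eq.sym p′))
    trans (t≈b p q) (P≈ p′)     = t≈b (P.Eq.trans (P.Eq.sym p′) p) q
    trans (t≈b p q) (b≈t p′ q′) = Q≈ (Q.Eq.trans q (Q.Eq.sym q′))

  -- _≤ᵍ_ written out case by case, to prove it antisymmetric and decidable.
  data _≼_ : Rel Carrier 0ℓ where
    PP : ∀ {x x′} → x P.≤ x′ → inj₁ x ≼ inj₁ x′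
    QQ : ∀ {y y′} → y Q.≤ y′ → inj₂ y ≼ inj₂ y′
    QP : ∀ {x y} → inj₂ y ≼ inj₁ x
    PQ : ∀ {x y} → x P.≤ b → t Q.≤ y → inj₁ x ≼ inj₂ y

  ⊑⇒≼ : ∀ {u v} → u ⊑ v → u ≼ v
  ⊑⇒≼ (P≤ p)          = PP p
  ⊑⇒≼ (Q≤ q)          = QQ q
  ⊑⇒≼ (≈⊑ (P≈ p))    = PP (P.reflexive p)
  ⊑⇒≼ (≈⊑ (Q≈ q))    = QQ (Q.reflexive q)
  ⊑⇒≼ (≈⊑ (b≈t p q)) = PQ (P.reflexive p) (Q.reflexive (Q.Eq.sym q))
  ⊑⇒≼ (≈⊑ (t≈b p q)) = QP

  ≼-trans : ∀ {u v w} → u ≼ v → v ≼ w → u ≼ w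
  ≼-trans (PP p)   (PP p′)    = PP (P.trans p p′)
  ≼-trans (PP p)   (PQ p′ q)  = PQ (P.trans p p′) q
  ≼-trans (QQ q)   (QQ q′)    = QQ (Q.trans q q′)
  ≼-trans (QQ q)   QP         = QP
  ≼-trans QP       (PP p)     = QP
  ≼-trans {inj₂ y} QP (PQ p q) = QQ (Q.trans (t-max y) q)
  ≼-trans (PQ p q) (QQ q′)    = PQ p (Q.trans q q′)
  ≼-trans {w = inj₁ x} (PQ p q) QP = PP (P.trans p (b-min x))

  ≤ᵍ⇒≼ : ∀ {u v} → u ≤ᵍ v → u ≼ v
  ≤ᵍ⇒≼ [ r ]    = ⊑⇒≼ r
  ≤ᵍ⇒≼ (r ∷ rs) = ≼-trans (⊑⇒≼ r) (≤ᵍ⇒≼ rs)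

  ≼⇒≤ᵍ : ∀ {u v} → u ≼ v → u ≤ᵍ v
  ≼⇒≤ᵍ (PP p) = [ P≤ p ]
  ≼⇒≤ᵍ (QQ q) = [ Q≤ q ]
  ≼⇒≤ᵍ (QP {x} {y}) =
    Q≤ (t-max y) ∷ ≈⊑ (t≈b P.Eq.refl Q.Eq.refl) ∷ [ P≤ (b-min x) ]
  ≼⇒≤ᵍ (PQ p q) = P≤ p ∷ ≈⊑ (b≈t P.Eq.refl Q.Eq.refl) ∷ [ Q≤ q ]

  ≼-antisym : ∀ {u v} → u ≼ v → v ≼ u → u ≈ v
  ≼-antisym (PP p)   (PP p′)  = P≈ (P.antisym p p′)
  ≼-antisym (QQ q)   (QQ q′)  = Q≈ (Q.antisym q q′)
  ≼-antisym {inj₂ y} {inj₁ x} QP (PQ p q) =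
    t≈b (P.antisym p (b-min x)) (Q.antisym (t-max y) q)
  ≼-antisym {inj₁ x} {inj₂ y} (PQ p q) QP =
    b≈t (P.antisym p (b-min x)) (Q.antisym (t-max y) q)

  _≼?_ : Decidable _≼_
  inj₁ x ≼? inj₁ x′ = map′ PP (λ { (PP p) → p }) (x P.≤? x′)
  inj₂ y ≼? inj₂ y′ = map′ QQ (λ { (QQ q) → q }) (y Q.≤? y′)
  inj₂ y ≼? inj₁ x  = yes QP
  inj₁ x ≼? inj₂ y  = map′ (λ { (p , q) → PQ p q }) (λ { (PQ p q) → p , q })
                            ((x P.≤? b) ×-dec (t Q.≤? y))

  _≈?_ : Decidable _≈_
  inj₁ x ≈? inj₁ x′ = map′ P≈ (λ { (P≈ p) → p }) (x P.≟ x′)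
  inj₂ y ≈? inj₂ y′ = map′ Q≈ (λ { (Q≈ q) → q }) (y Q.≟ y′)
  inj₁ x ≈? inj₂ y  = map′ (λ { (p , q) → b≈t p q }) (λ { (b≈t p q) → p , q })
                            ((x P.≟ b) ×-dec (y Q.≟ t))
  inj₂ y ≈? inj₁ x  = map′ (λ { (p , q) → t≈b p q }) (λ { (t≈b p q) → p , q })
                            ((x P.≟ b) ×-dec (y Q.≟ t))

  ≤ᵍ-isPartialOrder : IsPartialOrder _≈_ _≤ᵍ_
  ≤ᵍ-isPartialOrder = record
    { isPreorder = record
      { isEquivalence = ≈-isEquivalence
      ; reflexive     = λ e → [ ≈⊑ e ]
      ; trans         = _++⁺_
      }
    ; antisym    = λ r s → ≼-antisym (≤ᵍ⇒≼ r) (≤ᵍ⇒≼ s)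
    }

  glue : FinitePoset
  glue = record
    { decPoset   = record
      { isDecPartialOrder = record
        { isPartialOrder = ≤ᵍ-isPartialOrder
        ; _≟_            = _≈?_
        ; _≤?_           = λ u v → map′ ≼⇒≤ᵍ ≤ᵍ⇒≼ (u ≼? v)
        }
      }
    ; elements   = map inj₁ P.elements ++ map inj₂ Q.elements
    ; enumerates = λ where
        (inj₁ x) → ∈ₛ.∈-++⁺ˡ S (∈ₛ.∈-map⁺ P.Eq.setoid S P≈ (P.enumerates x))
        (inj₂ y) → ∈ₛ.∈-++⁺ʳ S _ (∈ₛ.∈-map⁺ Q.Eq.setoid S Q≈ (Q.enumerates y))
    ; nonempty   = inj₁ P.nonempty
    }
    where
    S = record { isEquivalence = ≈-isEquivalence }

open Glue public using (glue)

------------------------------------------------------------------------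
-- P-free families

-- No congruence condition on f is needed: it follows from monotonicity and
-- antisymmetry.
_WeakSubposetOf_ : Poset 0ℓ 0ℓ 0ℓ → Poset 0ℓ 0ℓ 0ℓ → Set
P′ WeakSubposetOf P =
  ∃[ f ] Injective P′._≈_ P._≈_ f × f Preserves P′._≤_ ⟶ P._≤_
  where
  module P′ = Poset P′
  module P  = Poset P

inclusionPoset : ∀ {n} → Pred (Subset n) 0ℓ → Poset 0ℓ 0ℓ 0ℓ
inclusionPoset {n} 𝓕 = On.poset (⊆-poset n) (proj₁ {B = 𝓕})

_IsFree_ : FinitePoset → ∀ {n} → Pred (Subset n) 0ℓ → Set
P IsFree 𝓕 = ¬ (FinitePoset.poset P WeakSubposetOf inclusionPoset 𝓕)

record Family (n : ℕ) : Set where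
  field
    members : List (Subset n)
    unique  : Unique members

  Mem : Pred (Subset n) 0ℓ
  Mem A = A ∈ members

  size : ℕ
  size = length members

open Family public using (Mem; size)

IsLargest : Pred ℕ 0ℓ → ℕ → Set
IsLargest Q m = Q m × (∀ k → Q k → k ≤ℕ m)

IsLa : FinitePoset → ℕ → ℕ → Set
IsLa P n = IsLargest λ k → ∃[ 𝓕 ] P IsFree (Mem {n} 𝓕) × size 𝓕 ≡ k

Levels : ∀ n → ℤ → ℕ → Pred (Subset n) 0ℓ
Levels n s k A = s ℤ.≤ + ∣ A ∣ × + ∣ A ∣ ℤ.< s ℤ.+ + k

IsE : FinitePoset → ℕ → Set
IsE P = IsLargest λ k → ∀ n s → P IsFree Levels n s k

------------------------------------------------------------------------
-- Lubell function

C-nonZero : ∀ {n k} → k ≤ℕ n → NonZero (n C k)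
C-nonZero {n} {zero} _ = _
C-nonZero {suc n} {suc k} (s≤s k≤n) =
  subst NonZero (nCk+nC[k+1]≡[n+1]C[k+1] n k) (+-nonZeroˡ (C-nonZero k≤n))
  where
  +-nonZeroˡ : ∀ {a b} → NonZero a → NonZero (a +ℕ b)
  +-nonZeroˡ {suc _} _ = _

weight : ∀ {n} → Subset n → ℚ
weight {n} A = (+ 1 / (n C ∣ A ∣)) {{C-nonZero (∣p∣≤n A)}}

-- A ∈ 𝓕 lies on a fraction 1 / C(n,|A|) of the full chains, so this sum is
-- the average of |𝓕 ∩ 𝒞| over all full chains 𝒞.
lubell : ∀ {n} → Family n → ℚ
lubell 𝓕 = foldr (λ A s → weight A + s) 0ℚ (Family.members 𝓕)

fromℕ : ℕ → ℚ
fromℕ k = + k / 1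

-- Rational β and ε suffice: the condition for β and ε implies it for every
-- smaller β and every larger ε.
LowerLBounded : FinitePoset → Set
LowerLBounded P = ∃[ e ] IsE P e ×
  (∀ (β ε : ℚ) → ½ < β → β < 1ℚ → 0ℚ < ε →
   ∃[ N ] ∀ n → N ≤ℕ n → (𝓕 : Family n) → P IsFree Mem 𝓕 →
   (∀ A → Mem 𝓕 A → fromℕ ∣ A ∣ < β * fromℕ n) →
   lubell 𝓕 ≤ fromℕ e + ε)

------------------------------------------------------------------------
-- π(P)

_ConvergesTo_ : (ℕ → ℚ) → ℚ → Set
a ConvergesTo L =
  ∀ ε → 0ℚ < ε → ∃[ N ] ∀ n → N ≤ℕ n → ∣ a n - L ∣ℚ < ε

IsPi : FinitePoset → ℚ → Set
IsPi P L = Σ[ La ∈ (ℕ → ℕ) ] (∀ n → IsLa P n (La n)) ×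
  (λ n → (+ La n / (n C ⌊ n /2⌋)) {{C-nonZero (⌊n/2⌋≤n n)}}) ConvergesTo L

{-# OPTIONS --safe #-}

-- Here e(P) = e(P₁) + e(P₂), and the e(P) levels upwards from the middle one
-- have about e(P) times the size of the middle level.  Conversely, in a P-free
-- family no member is both the bottom of a copy of P₁ and the top of a copy of
-- the dual of P₂.  So, up to the negligibly many sets of size outside
-- (n/4, 3n/4), the family is the union of a P₁-free family and of one whose
-- complements form a P₂-free family, and the two Lubell functions add up to at
-- most e(P₁) + e(P₂) + o(1).

module Submission where

open import Defs
open import Data.Product using (∃-syntax; _×_)
open import Relation.Binary.Definitions using (Minimum)

open import Algebra.Lattice.Properties.BooleanAlgebra using (¬-involutive)
import Data.Bool.Properties as Bool
open import Data.Fin.Base using (Fin; finToFun; funToFin)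
import Data.Fin.Properties as Fin
open import Data.Fin.Subset using (Subset; ∣_∣; ∁; _⊆_; inside; outside)
open import Data.Fin.Subset.Properties
  using ( ∣p∣≤n; ∣∁p∣≡n∸∣p∣; p⊆q⇒∁p⊇∁q; p⊆q⇒∣p∣≤∣q∣; ∪-∩-booleanAlgebra
        ; ⊆-refl; ⊆-reflexive; ⊆-trans; ⊆-antisym; _⊆?_)
open import Data.Integer.Base as ℤ using (+_; +[1+_]; -[1+_]; +0)
import Data.Integer.Properties as ℤ
import Data.Integer.Tactic.RingSolver as ℤ
open import Data.List.Base
  using (List; []; _∷_; [_]; _++_; map; length; filter; foldr; lookup)
open import Data.List.Membership.DecPropositional using () renaming (_∈?_ to mem?)
open import Data.List.Membership.Propositional using (_∈_)
open import Data.List.Membership.Propositional.Properties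
  using ( ∈-∃++; ∈-++⁻; ∈-++⁺ˡ; ∈-++⁺ʳ; ∈-map⁺; ∈-map⁻
        ; ∈-filter⁺; ∈-filter⁻; ∈-lookup)
open import Data.List.Properties using (length-map; length-++; map-++)
import Data.List.Relation.Binary.Permutation.Propositional.Properties as ↭
open import Data.List.Relation.Binary.Sublist.Propositional as Sublist
  using ([]; _∷_; _∷ʳ_)
import Data.List.Relation.Binary.Sublist.Propositional.Properties as Sublist
open import Data.List.Relation.Unary.All as All using ([]; _∷_)
open import Data.List.Relation.Unary.AllPairs using (AllPairs; []; _∷_)
open import Data.List.Relation.Unary.Any as Any using (here; there)
open import Data.List.Relation.Unary.Any.Properties using (lookup-index)
open import Data.List.Relation.Unary.Unique.Propositional using (Unique)
import Data.List.Relation.Unary.Unique.Propositional.Properties as Unique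
open import Data.Nat.Base hiding (_/_)
open import Data.Nat.Combinatorics using (_C_; nC1≡n; nCk+nC[k+1]≡[n+1]C[k+1])
open import Data.Nat.ListAction using (sum)
open import Data.Nat.ListAction.Properties using (sum-↭; sum-++)
open import Data.Nat.Properties
open import Data.Nat.Tactic.RingSolver using (solve-∀)
open import Data.Product.Base using (_,_; proj₁; proj₂; ∃; Σ-syntax; map₂)
open import Data.Rational.Base as ℚ using (ℚ; mkℚ; 0ℚ; _/_; ↧ₙ_; toℚᵘ)
import Data.Rational.Properties as ℚ
open import Algebra.Properties.AbelianGroup ℚ.+-0-abelianGroup using (⁻¹-anti-homo‿-)
open import Data.Rational.Unnormalised.Base as ℚᵘ using (mkℚᵘ)
import Data.Rational.Unnormalised.Properties as ℚᵘ
open import Data.Sum.Base using (_⊎_; inj₁; inj₂)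
open import Data.Vec.Base as Vec using ([]; _∷_; here; there)
open import Data.Vec.Properties using (≡-dec; ∷-injectiveʳ; ++-injectiveˡ; ++-injectiveʳ)
open import Function.Base using (_∘_)
open import Level using (0ℓ)
open import Relation.Binary.Definitions using (DecidableEquality)
open import Relation.Binary.PropositionalEquality hiding ([_])
open import Relation.Nullary using (Dec; yes; no; ¬_; ¬?; contradiction)
open import Relation.Nullary.Decidable using (map′; _×-dec_; _→-dec_; from-yes)
open import Relation.Unary using (Pred; Decidable)

-- The hypothesis controls only sets of size below βn for some β < 1, and the part of a copy below
-- the shared element is handled through complements. So a set and its complement must both be below
-- βn, which forces a cut on both sides; 3/4 is a convenient β in (1/2, 1).
--
-- Splitting by the single property of being the bottom of a copy of P₁ is enough because a copy of
-- P₁ and a copy of the dual of P₂ that share this extreme set cannot meet anywhere else: one lies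
-- above it and the other below. The copy of P₁ may therefore use any sets of the middle family.
--
-- The upper estimate comes out in terms of e₁ + e₂, whereas e(P) is defined by a maximum, so e(P) =
-- e₁ + e₂ needs both inequalities.
--
-- The estimates stay in ℕ, multiplied by d = 5q with q the denominator of ε: each of the two Lubell
-- bounds and each of the two tails costs one central coefficient, so 4/d in all. Splitting a family
-- and choosing La(n, P) both require deciding whether a copy exists, hence the exhaustive searches.

-- Binomial coefficients

-- (k + 1) C(n, k + 1) = (n − k) C(n, k), without subtraction.
C-ratio : ∀ n k → suc k * (n C suc k) + k * (n C k) ≡ n * (n C k)
C-ratio zero    zero    = refl
C-ratio zero    (suc k) = cong₂ _+_ (*-zeroʳ (suc (suc k))) (*-zeroʳ (suc k))
C-ratio (suc n) zero    = trans (cong (λ c → 1 * c + 0) (nC1≡n (suc n))) (lemma n)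
  where
  lemma : ∀ n → 1 * suc n + 0 ≡ suc n * 1
  lemma = solve-∀
C-ratio (suc n) (suc k) = begin
  suc (suc k) * (suc n C suc (suc k)) + suc k * (suc n C suc k)
    ≡⟨ cong₂ (λ x y → suc (suc k) * x + suc k * y)
         (nCk+nC[k+1]≡[n+1]C[k+1] n (suc k)) (nCk+nC[k+1]≡[n+1]C[k+1] n k) ⟨
  suc (suc k) * (a₁ + a₂) + suc k * (a₀ + a₁)
    ≡⟨ regroup k a₀ a₁ a₂ ⟩
  (suc (suc k) * a₂ + suc k * a₁) + (suc k * a₁ + k * a₀) + (a₀ + a₁)
    ≡⟨ cong₂ (λ x y → x + y + (a₀ + a₁)) (C-ratio n (suc k)) (C-ratio n k) ⟩
  n * a₁ + n * a₀ + (a₀ + a₁)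
    ≡⟨ collect n a₀ a₁ ⟩
  suc n * (a₀ + a₁)
    ≡⟨ cong (suc n *_) (nCk+nC[k+1]≡[n+1]C[k+1] n k) ⟩
  suc n * (suc n C suc k) ∎
  where
  open ≡-Reasoning
  a₀ a₁ a₂ : ℕ
  a₀ = n C k
  a₁ = n C suc k
  a₂ = n C suc (suc k)
  regroup : ∀ k a b c → suc (suc k) * (b + c) + suc k * (a + b) ≡
                        (suc (suc k) * c + suc k * b) + (suc k * b + k * a) + (a + b)
  regroup = solve-∀
  collect : ∀ n a b → n * b + n * a + (a + b) ≡ suc n * (a + b)
  collect = solve-∀

centre : ℕ → ℕ
centre n = n C ⌊ n /2⌋

2*⌊n/2⌋≤n : ∀ n → 2 * ⌊ n /2⌋ ≤ n
2*⌊n/2⌋≤n zero          = z≤n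
2*⌊n/2⌋≤n (suc zero)    = z≤n
2*⌊n/2⌋≤n (suc (suc n)) = ≤-trans (≤-reflexive (*-suc 2 ⌊ n /2⌋)) (s≤s (s≤s (2*⌊n/2⌋≤n n)))

n≤1+2*⌊n/2⌋ : ∀ n → n ≤ 1 + 2 * ⌊ n /2⌋
n≤1+2*⌊n/2⌋ zero          = z≤n
n≤1+2*⌊n/2⌋ (suc zero)    = s≤s z≤n
n≤1+2*⌊n/2⌋ (suc (suc n)) = ≤-trans (s≤s (s≤s (n≤1+2*⌊n/2⌋ n))) (≤-reflexive (cong suc (sym (*-suc 2 ⌊ n /2⌋))))

private
  split-1+2k : ∀ k a → (1 + 2 * k) * a ≡ suc k * a + k * a
  split-1+2k = solve-∀

-- By `C-ratio` consecutive coefficients have quotient (n - k)/(k + 1), which the hypothesis makes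
-- at least 1.
C-increasing : ∀ {n k} → 1 + 2 * k ≤ n → n C k ≤ n C suc k
C-increasing {n} {k} 1+2k≤n = *-cancelˡ-≤ (suc k) (+-cancelʳ-≤ (k * (n C k)) _ _ (begin
  suc k * (n C k) + k * (n C k)      ≡⟨ split-1+2k k (n C k) ⟨
  (1 + 2 * k) * (n C k)              ≤⟨ *-monoˡ-≤ (n C k) 1+2k≤n ⟩
  n * (n C k)                        ≡⟨ C-ratio n k ⟨
  suc k * (n C suc k) + k * (n C k)  ∎))
  where open ≤-Reasoning

C-decreasing : ∀ {n k} → n ≤ 1 + 2 * k → n C suc k ≤ n C k
C-decreasing {n} {k} n≤1+2k = *-cancelˡ-≤ (suc k) (+-cancelʳ-≤ (k * (n C k)) _ _ (begin
  suc k * (n C suc k) + k * (n C k)  ≡⟨ C-ratio n k ⟩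
  n * (n C k)                        ≤⟨ *-monoˡ-≤ (n C k) n≤1+2k ⟩
  (1 + 2 * k) * (n C k)              ≡⟨ split-1+2k k (n C k) ⟩
  suc k * (n C k) + k * (n C k)      ∎))
  where open ≤-Reasoning

C≤centre : ∀ n k → n C k ≤ centre n
C≤centre n k with ≤-total k ⌊ n /2⌋
... | inj₁ k≤h = below (≤⇒≤′ k≤h) (2*⌊n/2⌋≤n n)
  where
  below : ∀ {h} → k ≤′ h → 2 * h ≤ n → n C k ≤ n C h
  below ≤′-refl             _      = ≤-refl
  below (≤′-step {h} k≤′h) 2[1+h]≤n = ≤-trans (below k≤′h (≤-trans (n≤1+n _) 1+2h≤n)) (C-increasing 1+2h≤n)
    where
    1+2h≤n : 1 + 2 * h ≤ n
    1+2h≤n = ≤-trans (≤-trans (n≤1+n _) (≤-reflexive (sym (*-suc 2 h)))) 2[1+h]≤n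
... | inj₂ h≤k = above (≤⇒≤′ h≤k)
  where
  above : ∀ {k} → ⌊ n /2⌋ ≤′ k → n C k ≤ centre n
  above ≤′-refl         = ≤-refl
  above (≤′-step h≤′k) = ≤-trans
    (C-decreasing (≤-trans (n≤1+2*⌊n/2⌋ n) (s≤s (*-monoʳ-≤ 2 (≤′⇒≤ h≤′k))))) (above h≤′k)

-- Going from level h + j to level h + j + 1 loses at most the fraction
-- (2j + 1) / (h + 1) of the central coefficient, and the odd numbers add up to j².
C-near-centre : ∀ n j → let h = ⌊ n /2⌋ in
                suc h * centre n ≤ suc h * (n C (h + j)) + j * j * centre n
C-near-centre n zero    = ≤-reflexive (sym (trans (+-identityʳ _) (cong (λ k → suc ⌊ n /2⌋ * (n C k)) (+-identityʳ ⌊ n /2⌋))))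
C-near-centre n (suc j) = begin
  suc h * M                                    ≤⟨ C-near-centre n j ⟩
  suc h * c + j * j * M                        ≤⟨ +-monoˡ-≤ (j * j * M) step ⟩
  suc h * c′ + (j * M + suc j * M) + j * j * M ≡⟨ collect h j c′ M ⟩
  suc h * c′ + suc j * suc j * M               ≡⟨ cong (λ k → suc h * (n C k) + suc j * suc j * M) (+-suc h j) ⟨
  suc h * (n C (h + suc j)) + suc j * suc j * M ∎
  where
  open ≤-Reasoning
  h M c c′ : ℕ
  h  = ⌊ n /2⌋
  M  = centre n
  c  = n C (h + j)
  c′ = n C suc (h + j)
  collect : ∀ h j c m → suc h * c + (j * m + suc j * m) + j * j * m ≡ suc h * c + suc j * suc j * m
  collect = solve-∀
  regroup₁ : ∀ h j c → suc h * c + (h + j) * c ≡ 2 * h * c + suc j * c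
  regroup₁ = solve-∀
  regroup₂ : ∀ h j c c′ → suc (h + j) * c′ + (h + j) * c + suc j * c ≡
                          suc h * c′ + (j * c′ + suc j * c) + (h + j) * c
  regroup₂ = solve-∀
  -- `C-ratio` and 2h ≤ n give (h + 1)c ≤ (h + 1)c′ + jc′ + (j + 1)c; bounding c and c′ in the error
  -- by M leaves 2j + 1 times M.
  step : suc h * c ≤ suc h * c′ + (j * M + suc j * M)
  step = ≤-trans (+-cancelʳ-≤ ((h + j) * c) _ _ (begin
    suc h * c + (h + j) * c                        ≡⟨ regroup₁ h j c ⟩
    2 * h * c + suc j * c                          ≤⟨ +-monoˡ-≤ (suc j * c) (*-monoˡ-≤ c (2*⌊n/2⌋≤n n)) ⟩
    n * c + suc j * c                              ≡⟨ cong (_+ suc j * c) (C-ratio n (h + j)) ⟨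
    suc (h + j) * c′ + (h + j) * c + suc j * c     ≡⟨ regroup₂ h j c c′ ⟩
    suc h * c′ + (j * c′ + suc j * c) + (h + j) * c ∎))
    (+-monoʳ-≤ (suc h * c′) (+-mono-≤ (*-monoʳ-≤ j (C≤centre n (suc (h + j)))) (*-monoʳ-≤ (suc j) (C≤centre n (h + j)))))

-- The n + 1 coefficients sum to 2^n, so the largest is at least their average. The induction avoids
-- the sum: by Pascal's rule it needs only n C(n, h) ≤ (n + 2) C(n, h + 1), which `C-ratio` reduces
-- to 2h ≤ n.
2^n≤[1+n]*centre : ∀ n → 2 ^ n ≤ suc n * centre n
2^n≤[1+n]*centre zero    = ≤-refl
2^n≤[1+n]*centre (suc n) = begin
  2 * 2 ^ n                          ≤⟨ *-monoʳ-≤ 2 (2^n≤[1+n]*centre n) ⟩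
  2 * (suc n * a₀)                   ≡⟨ regroup₁ n a₀ ⟩
  suc (suc n) * a₀ + n * a₀          ≤⟨ +-monoʳ-≤ (suc (suc n) * a₀) (*-cancelˡ-≤ (suc h) (+-cancelʳ-≤ (suc (suc n) * (h * a₀)) _ _ step)) ⟩
  suc (suc n) * a₀ + suc (suc n) * a₁ ≡⟨ *-distribˡ-+ (suc (suc n)) a₀ a₁ ⟨
  suc (suc n) * (a₀ + a₁)            ≡⟨ cong (suc (suc n) *_) (nCk+nC[k+1]≡[n+1]C[k+1] n h) ⟩
  suc (suc n) * (suc n C suc h)      ≤⟨ *-monoʳ-≤ (suc (suc n)) (C≤centre (suc n) (suc h)) ⟩
  suc (suc n) * centre (suc n)       ∎
  where
  open ≤-Reasoning
  h a₀ a₁ : ℕ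
  h  = ⌊ n /2⌋
  a₀ = centre n
  a₁ = n C suc h
  regroup₁ : ∀ n a → 2 * (suc n * a) ≡ suc (suc n) * a + n * a
  regroup₁ = solve-∀
  regroup₂ : ∀ n h a → suc h * (n * a) + suc (suc n) * (h * a) ≡ (suc n * (2 * h) + n) * a
  regroup₂ = solve-∀
  regroup₃ : ∀ n a → (suc n * n + n) * a ≡ suc (suc n) * (n * a)
  regroup₃ = solve-∀
  regroup₄ : ∀ n h a b → suc (suc n) * (suc h * b + h * a) ≡ suc h * (suc (suc n) * b) + suc (suc n) * (h * a)
  regroup₄ = solve-∀
  step : suc h * (n * a₀) + suc (suc n) * (h * a₀) ≤ suc h * (suc (suc n) * a₁) + suc (suc n) * (h * a₀)
  step = begin
    suc h * (n * a₀) + suc (suc n) * (h * a₀)    ≡⟨ regroup₂ n h a₀ ⟩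
    (suc n * (2 * h) + n) * a₀                   ≤⟨ *-monoˡ-≤ a₀ (+-monoˡ-≤ n (*-monoʳ-≤ (suc n) (2*⌊n/2⌋≤n n))) ⟩
    (suc n * n + n) * a₀                         ≡⟨ regroup₃ n a₀ ⟩
    suc (suc n) * (n * a₀)                       ≡⟨ cong (suc (suc n) *_) (C-ratio n h) ⟨
    suc (suc n) * (suc h * a₁ + h * a₀)          ≡⟨ regroup₄ n h a₀ a₁ ⟩
    suc h * (suc (suc n) * a₁) + suc (suc n) * (h * a₀) ∎

-- 108 (n + 20)² exceeds 97 (n + 21)² by 11 n² + 246 n + 423.
97^n*[n+20]²≤400*108^n : ∀ n → 97 ^ n * ((n + 20) * (n + 20)) ≤ 400 * 108 ^ n
97^n*[n+20]²≤400*108^n zero    = ≤-refl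
97^n*[n+20]²≤400*108^n (suc n) = begin
  97 * 97 ^ n * ((suc n + 20) * (suc n + 20))
    ≤⟨ m≤m+n _ ((11 * (n * n) + 246 * n + 423) * 97 ^ n) ⟩
  97 * 97 ^ n * ((suc n + 20) * (suc n + 20)) + (11 * (n * n) + 246 * n + 423) * 97 ^ n
    ≡⟨ expand n (97 ^ n) ⟩
  108 * (97 ^ n * ((n + 20) * (n + 20)))
    ≤⟨ *-monoʳ-≤ 108 (97^n*[n+20]²≤400*108^n n) ⟩
  108 * (400 * 108 ^ n)
    ≡⟨ commute (108 ^ n) ⟩
  400 * (108 * 108 ^ n) ∎
  where
  open ≤-Reasoning
  expand : ∀ n x → 97 * x * ((suc n + 20) * (suc n + 20)) + (11 * (n * n) + 246 * n + 423) * x ≡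
                   108 * (x * ((n + 20) * (n + 20)))
  expand = solve-∀
  commute : ∀ x → 108 * (400 * x) ≡ 400 * (108 * x)
  commute = solve-∀

-- Since d ≤ n/400, the factor d(n + 1) is at most n(n + 1)/400, hence at most (n + 20)²/400. The
-- shift by 20 is large enough for the induction on (n + 20)² to start at n = 0, and 400 is its
-- value there.
97^n-negligible : ∀ d n → 400 * d ≤ n → d * (suc n * 97 ^ n) ≤ 108 ^ n
97^n-negligible d n 400d≤n = *-cancelˡ-≤ 400 (begin
  400 * (d * (suc n * 97 ^ n))       ≡⟨ *-assoc 400 d _ ⟨
  400 * d * (suc n * 97 ^ n)         ≤⟨ *-monoˡ-≤ (suc n * 97 ^ n) 400d≤n ⟩
  n * (suc n * 97 ^ n)               ≤⟨ m≤m+n _ ((39 * n + 400) * 97 ^ n) ⟩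
  n * (suc n * 97 ^ n) + (39 * n + 400) * 97 ^ n ≡⟨ expand n (97 ^ n) ⟩
  97 ^ n * ((n + 20) * (n + 20))     ≤⟨ 97^n*[n+20]²≤400*108^n n ⟩
  400 * 108 ^ n                      ∎)
  where
  open ≤-Reasoning
  expand : ∀ n x → n * (suc n * x) + (39 * n + 400) * x ≡ x * ((n + 20) * (n + 20))
  expand = solve-∀

-- Families of sets

module _ {a} {A : Set a} where

  -- As `xs` has no repetitions, each of its entries can be matched with an occurrence of its own in
  -- `ys`; the unmatched rest of `ys` contributes a nonnegative amount.
  sum-map-mono-⊆ : (f : A → ℕ) → ∀ {xs ys} → Unique xs → (∀ {x} → x ∈ xs → x ∈ ys) →
                   sum (map f xs) ≤ sum (map f ys)
  sum-map-mono-⊆ f {[]}     _            _     = z≤n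
  sum-map-mono-⊆ f {x ∷ xs} (x∉xs ∷ xs!) xs⊆ys with ∈-∃++ (xs⊆ys (here refl))
  ... | as , bs , refl = begin
    f x + sum (map f xs)          ≤⟨ +-monoʳ-≤ (f x) (sum-map-mono-⊆ f xs! xs⊆as++bs) ⟩
    sum (map f (x ∷ as ++ bs))    ≡⟨ sum-↭ (↭.map⁺ f (↭.shift x as bs)) ⟨
    sum (map f (as ++ x ∷ bs))    ∎
    where
    open ≤-Reasoning
    xs⊆as++bs : ∀ {y} → y ∈ xs → y ∈ as ++ bs
    xs⊆as++bs y∈xs with ∈-++⁻ as (xs⊆ys (there y∈xs))
    ... | inj₁ y∈as         = ∈-++⁺ˡ y∈as
    ... | inj₂ (here refl)  = contradiction refl (All.lookup x∉xs y∈xs)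
    ... | inj₂ (there y∈bs) = ∈-++⁺ʳ as y∈bs

  sum-map-≥ : (f : A → ℕ) (c : ℕ) → ∀ xs → (∀ {x} → x ∈ xs → c ≤ f x) → length xs * c ≤ sum (map f xs)
  sum-map-≥ f c []       c≤f = z≤n
  sum-map-≥ f c (x ∷ xs) c≤f = +-mono-≤ (c≤f (here refl)) (sum-map-≥ f c xs (c≤f ∘ there))

  sum-map-1 : ∀ (xs : List A) → sum (map (λ _ → 1) xs) ≡ length xs
  sum-map-1 []       = refl
  sum-map-1 (x ∷ xs) = cong suc (sum-map-1 xs)

  length-mono-⊆ : ∀ {xs ys : List A} → Unique xs → (∀ {x} → x ∈ xs → x ∈ ys) → length xs ≤ length ys
  length-mono-⊆ {xs} {ys} xs! xs⊆ys =
    subst₂ _≤_ (sum-map-1 xs) (sum-map-1 ys) (sum-map-mono-⊆ (λ _ → 1) xs! xs⊆ys)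

  length-filter-¬ : ∀ {p} {P : Pred A p} (P? : Decidable P) xs →
                    length xs ≡ length (filter P? xs) + length (filter (¬? ∘ P?) xs)
  length-filter-¬ P? []       = refl
  length-filter-¬ P? (x ∷ xs) with P? x
  ... | yes _ = cong suc (length-filter-¬ P? xs)
  ... | no  _ = trans (cong suc (length-filter-¬ P? xs)) (sym (+-suc _ _))

∁-involutive : ∀ {n} (A : Subset n) → ∁ (∁ A) ≡ A
∁-involutive {n} = ¬-involutive (∪-∩-booleanAlgebra n)

∁-injective : ∀ {n} {A B : Subset n} → ∁ A ≡ ∁ B → A ≡ B
∁-injective {A = A} {B} eq = trans (sym (∁-involutive A)) (trans (cong ∁ eq) (∁-involutive B))

∣A∣+∣∁A∣≡n : ∀ {n} (A : Subset n) → ∣ A ∣ + ∣ ∁ A ∣ ≡ n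
∣A∣+∣∁A∣≡n A = trans (cong (λ m → ∣ A ∣ + m) (∣∁p∣≡n∸∣p∣ A)) (m+[n∸m]≡n (∣p∣≤n A))

-- Counting the sets far from the middle level

subsets : ∀ n → List (Subset n)
subsets zero    = [ [] ]
subsets (suc n) = map (inside ∷_) (subsets n) ++ map (outside ∷_) (subsets n)

∈-subsets : ∀ {n} (A : Subset n) → A ∈ subsets n
∈-subsets []            = here refl
∈-subsets (inside ∷ A)  = ∈-++⁺ˡ (∈-map⁺ (inside ∷_) (∈-subsets A))
∈-subsets (outside ∷ A) = ∈-++⁺ʳ (map (inside ∷_) (subsets _)) (∈-map⁺ (outside ∷_) (∈-subsets A))

unique-inside++outside : ∀ {n} {xs ys : List (Subset n)} → Unique xs → Unique ys →
                         Unique (map (inside ∷_) xs ++ map (outside ∷_) ys)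
unique-inside++outside xs! ys! =
  Unique.++⁺ (Unique.map⁺ ∷-injectiveʳ xs!) (Unique.map⁺ ∷-injectiveʳ ys!) disjoint
  where
  disjoint : ∀ {A} → ¬ (A ∈ map (inside ∷_) _ × A ∈ map (outside ∷_) _)
  disjoint (p , q) with ∈-map⁻ (inside ∷_) p | ∈-map⁻ (outside ∷_) q
  ... | _ , _ , refl | _ , _ , ()

subsets-unique : ∀ n → Unique (subsets n)
subsets-unique zero    = [] ∷ []
subsets-unique (suc n) = unique-inside++outside (subsets-unique n) (subsets-unique n)

-- Up to the factor (a + b)^n this is the probability of `A` when every element is chosen
-- independently with probability a/(a + b). It is used with the fourth powers 81 = 3^4 and 16 =
-- 2^4, which make the weight at size 3n/4 the integer power 54^n = (3^3 · 2)^n; the bound beats 2^n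
-- because 81 + 16 = 97 is below 2 · 54 = 108.
bernoulliWeight : ℕ → ℕ → ∀ {n} → Subset n → ℕ
bernoulliWeight a b A = a ^ ∣ A ∣ * b ^ ∣ ∁ A ∣

sum-bernoulliWeight : ∀ a b n → sum (map (bernoulliWeight a b) (subsets n)) ≡ (a + b) ^ n
sum-bernoulliWeight a b zero    = refl
sum-bernoulliWeight a b (suc n) = begin
  sum (map w (map (inside ∷_) (subsets n) ++ map (outside ∷_) (subsets n)))
    ≡⟨ cong sum (map-++ w (map (inside ∷_) (subsets n)) _) ⟩
  sum (map w (map (inside ∷_) (subsets n)) ++ map w (map (outside ∷_) (subsets n)))
    ≡⟨ sum-++ (map w (map (inside ∷_) (subsets n))) _ ⟩
  sum (map w (map (inside ∷_) (subsets n))) + sum (map w (map (outside ∷_) (subsets n)))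
    ≡⟨ cong₂ _+_ (scale inside a (λ A → *-assoc a (a ^ ∣ A ∣) _) (subsets n))
                 (scale outside b (λ A → swap b (a ^ ∣ A ∣) (b ^ ∣ ∁ A ∣)) (subsets n)) ⟩
  a * sum (map w (subsets n)) + b * sum (map w (subsets n))
    ≡⟨ *-distribʳ-+ (sum (map w (subsets n))) a b ⟨
  (a + b) * sum (map w (subsets n))
    ≡⟨ cong ((a + b) *_) (sum-bernoulliWeight a b n) ⟩
  (a + b) ^ suc n ∎
  where
  open ≡-Reasoning
  w : ∀ {n} → Subset n → ℕ
  w = bernoulliWeight a b
  swap : ∀ b x y → x * (b * y) ≡ b * (x * y)
  swap = solve-∀
  scale : ∀ s c → (∀ (A : Subset n) → w (s ∷ A) ≡ c * w A) → ∀ xs →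
          sum (map w (map (s ∷_) xs)) ≡ c * sum (map w xs)
  scale s c eq []       = sym (*-zeroʳ c)
  scale s c eq (A ∷ xs) = trans (cong₂ _+_ (eq A) (scale s c eq xs)) (sym (*-distribˡ-+ c (w A) _))

^-distribʳ-* : ∀ m x y → (x * y) ^ m ≡ x ^ m * y ^ m
^-distribʳ-* zero    x y = refl
^-distribʳ-* (suc m) x y = trans (cong (x * y *_) (^-distribʳ-* m x y)) (interchange x y (x ^ m) (y ^ m))
  where
  interchange : ∀ x y u v → x * y * (u * v) ≡ x * u * (y * v)
  interchange = solve-∀

-- 81^k 16^(n − k) = 54^n at k = 3n/4.
54^n≤bernoulliWeight : ∀ {n} (A : Subset n) → 3 * n ≤ 4 * ∣ A ∣ → 54 ^ n ≤ bernoulliWeight 81 16 A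
54^n≤bernoulliWeight {n} A 3n≤4k = begin
  54 ^ n                         ≡⟨ cong (54 ^_) (∣A∣+∣∁A∣≡n A) ⟨
  54 ^ (k + l)                   ≡⟨ cong (λ m → 54 ^ (m + l)) k≡3l+r ⟩
  54 ^ (3 * l + r + l)           ≡⟨ cong (54 ^_) (regroup l r) ⟩
  54 ^ (4 * l + r)               ≡⟨ ^-distribˡ-+-* 54 (4 * l) r ⟩
  54 ^ (4 * l) * 54 ^ r          ≤⟨ *-monoʳ-≤ (54 ^ (4 * l)) (^-monoˡ-≤ r (m≤m+n 54 27)) ⟩
  -- 54^4 and 81^3 · 16 are the same number, 2^4 · 3^12, so the replacement holds by evaluation.
  54 ^ (4 * l) * 81 ^ r          ≡⟨ cong (_* 81 ^ r) (^-*-assoc 54 4 l) ⟨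
  (81 ^ 3 * 16) ^ l * 81 ^ r     ≡⟨ cong (_* 81 ^ r) (^-distribʳ-* l (81 ^ 3) 16) ⟩
  (81 ^ 3) ^ l * 16 ^ l * 81 ^ r ≡⟨ cong (λ m → m * 16 ^ l * 81 ^ r) (^-*-assoc 81 3 l) ⟩
  81 ^ (3 * l) * 16 ^ l * 81 ^ r ≡⟨ swap (81 ^ (3 * l)) (16 ^ l) (81 ^ r) ⟩
  81 ^ (3 * l) * 81 ^ r * 16 ^ l ≡⟨ cong (_* 16 ^ l) (^-distribˡ-+-* 81 (3 * l) r) ⟨
  81 ^ (3 * l + r) * 16 ^ l      ≡⟨ cong (λ m → 81 ^ m * 16 ^ l) k≡3l+r ⟨
  81 ^ k * 16 ^ l                ∎
  where
  open ≤-Reasoning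
  k l r : ℕ
  k = ∣ A ∣
  l = ∣ ∁ A ∣
  r = k ∸ 3 * l
  3k+3l≤3k+k : 3 * k + 3 * l ≤ 3 * k + k
  3k+3l≤3k+k = begin
    3 * k + 3 * l ≡⟨ *-distribˡ-+ 3 k l ⟨
    3 * (k + l)   ≡⟨ cong (3 *_) (∣A∣+∣∁A∣≡n A) ⟩
    3 * n         ≤⟨ 3n≤4k ⟩
    4 * k         ≡⟨ +-comm k (3 * k) ⟩
    3 * k + k     ∎
  k≡3l+r : k ≡ 3 * l + r
  k≡3l+r = sym (m+[n∸m]≡n (+-cancelˡ-≤ (3 * k) _ _ 3k+3l≤3k+k))
  regroup : ∀ l r → 3 * l + r + l ≡ 4 * l + r
  regroup = solve-∀
  swap : ∀ x y z → x * y * z ≡ x * z * y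
  swap = solve-∀

-- A Chernoff bound: the sets of size at least 3n/4 number at most (97/54)^n,
-- which is exponentially smaller than 2^n.
large-sets-negligible : ∀ d n → 400 * d ≤ n → (xs : List (Subset n)) → Unique xs →
                        (∀ {A} → A ∈ xs → 3 * n ≤ 4 * ∣ A ∣) → d * length xs ≤ centre n
large-sets-negligible d n 400d≤n xs xs! large =
  *-cancelˡ-≤ (108 ^ n) {{m^n≢0 108 n}} (begin
    108 ^ n * (d * t)                  ≡⟨ cong (_* (d * t)) (^-distribʳ-* n 54 2) ⟩
    54 ^ n * 2 ^ n * (d * t)           ≡⟨ regroup₁ (54 ^ n) (2 ^ n) d t ⟩
    d * (t * 54 ^ n) * 2 ^ n           ≤⟨ *-mono-≤ (*-monoʳ-≤ d chernoff) (2^n≤[1+n]*centre n) ⟩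
    d * 97 ^ n * (suc n * centre n)    ≡⟨ regroup₂ d (97 ^ n) (suc n) (centre n) ⟩
    d * (suc n * 97 ^ n) * centre n    ≤⟨ *-monoˡ-≤ (centre n) (97^n-negligible d n 400d≤n) ⟩
    108 ^ n * centre n                 ∎)
  where
  open ≤-Reasoning
  t : ℕ
  t = length xs
  chernoff : t * 54 ^ n ≤ 97 ^ n
  chernoff = begin
    t * 54 ^ n
      ≤⟨ sum-map-≥ (bernoulliWeight 81 16) (54 ^ n) xs (λ {A} A∈ → 54^n≤bernoulliWeight A (large A∈)) ⟩
    sum (map (bernoulliWeight 81 16) xs)
      ≤⟨ sum-map-mono-⊆ (bernoulliWeight 81 16) xs! (λ {A} _ → ∈-subsets A) ⟩
    sum (map (bernoulliWeight 81 16) (subsets n))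
      ≡⟨ sum-bernoulliWeight 81 16 n ⟩
    97 ^ n ∎
  regroup₁ : ∀ x y d t → x * y * (d * t) ≡ d * (t * x) * y
  regroup₁ = solve-∀
  regroup₂ : ∀ d x n c → d * x * (n * c) ≡ d * (n * x) * c
  regroup₂ = solve-∀

small-sets-negligible : ∀ d n → 400 * d ≤ n → (xs : List (Subset n)) → Unique xs →
                        (∀ {A} → A ∈ xs → 4 * ∣ A ∣ ≤ n) → d * length xs ≤ centre n
small-sets-negligible d n 400d≤n xs xs! small =
  subst (λ t → d * t ≤ centre n) (length-map ∁ xs)
    (large-sets-negligible d n 400d≤n (map ∁ xs) (Unique.map⁺ ∁-injective xs!) large)
  where
  open ≤-Reasoning
  large : ∀ {B} → B ∈ map ∁ xs → 3 * n ≤ 4 * ∣ B ∣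
  large B∈ with ∈-map⁻ ∁ B∈
  ... | A , A∈ , refl = +-cancelˡ-≤ (4 * ∣ A ∣) _ _ (begin
    4 * ∣ A ∣ + 3 * n          ≤⟨ +-monoˡ-≤ (3 * n) (small A∈) ⟩
    4 * n                      ≡⟨ cong (4 *_) (∣A∣+∣∁A∣≡n A) ⟨
    4 * (∣ A ∣ + ∣ ∁ A ∣)      ≡⟨ *-distribˡ-+ 4 ∣ A ∣ ∣ ∁ A ∣ ⟩
    4 * ∣ A ∣ + 4 * ∣ ∁ A ∣    ∎)

-- Levels of the cube

layer : ∀ n → ℕ → List (Subset n)
layer zero    zero    = [ [] ]
layer zero    (suc k) = []
layer (suc n) zero    = map (outside ∷_) (layer n zero)
layer (suc n) (suc k) = map (inside ∷_) (layer n k) ++ map (outside ∷_) (layer n (suc k))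

length-layer : ∀ n k → length (layer n k) ≡ n C k
length-layer zero    zero    = refl
length-layer zero    (suc k) = refl
length-layer (suc n) zero    = trans (length-map (outside ∷_) (layer n zero)) (length-layer n zero)
length-layer (suc n) (suc k) = begin
  length (map (inside ∷_) (layer n k) ++ map (outside ∷_) (layer n (suc k)))
    ≡⟨ length-++ (map (inside ∷_) (layer n k)) ⟩
  length (map (inside ∷_) (layer n k)) + length (map (outside ∷_) (layer n (suc k)))
    ≡⟨ cong₂ _+_ (trans (length-map (inside ∷_) (layer n k)) (length-layer n k))
                 (trans (length-map (outside ∷_) (layer n (suc k))) (length-layer n (suc k))) ⟩
  n C k + n C suc k
    ≡⟨ nCk+nC[k+1]≡[n+1]C[k+1] n k ⟩
  suc n C suc k ∎
  where open ≡-Reasoning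

layer-unique : ∀ n k → Unique (layer n k)
layer-unique zero    zero    = [] ∷ []
layer-unique zero    (suc k) = []
layer-unique (suc n) zero    = Unique.map⁺ ∷-injectiveʳ (layer-unique n zero)
layer-unique (suc n) (suc k) = unique-inside++outside (layer-unique n k) (layer-unique n (suc k))

∈-layer⁻ : ∀ n k {A} → A ∈ layer n k → ∣ A ∣ ≡ k
∈-layer⁻ zero    zero    (here refl) = refl
∈-layer⁻ (suc n) zero    A∈ with ∈-map⁻ (outside ∷_) A∈
... | _ , B∈ , refl = ∈-layer⁻ n zero B∈
∈-layer⁻ (suc n) (suc k) A∈ with ∈-++⁻ (map (inside ∷_) (layer n k)) A∈
... | inj₁ A∈ˡ with ∈-map⁻ (inside ∷_) A∈ˡ
...   | _ , B∈ , refl = cong suc (∈-layer⁻ n k B∈)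
∈-layer⁻ (suc n) (suc k) A∈ | inj₂ A∈ʳ with ∈-map⁻ (outside ∷_) A∈ʳ
...   | _ , B∈ , refl = ∈-layer⁻ n (suc k) B∈

layers : ∀ n → ℕ → ℕ → List (Subset n)
layers n s zero    = []
layers n s (suc k) = layer n (s + k) ++ layers n s k

∈-layers⁻ : ∀ n s k {A} → A ∈ layers n s k → s ≤ ∣ A ∣ × ∣ A ∣ < s + k
∈-layers⁻ n s (suc k) A∈ with ∈-++⁻ (layer n (s + k)) A∈
... | inj₁ A∈ˡ = subst (λ m → s ≤ m × m < s + suc k) (sym (∈-layer⁻ n (s + k) A∈ˡ))
                   (m≤m+n s k , ≤-reflexive (sym (+-suc s k)))
... | inj₂ A∈ʳ = map₂ (λ lt → <-≤-trans lt (+-monoʳ-≤ s (n≤1+n k))) (∈-layers⁻ n s k A∈ʳ)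

layers-unique : ∀ n s k → Unique (layers n s k)
layers-unique n s zero    = []
layers-unique n s (suc k) = Unique.++⁺ (layer-unique n (s + k)) (layers-unique n s k) disjoint
  where
  disjoint : ∀ {A} → ¬ (A ∈ layer n (s + k) × A ∈ layers n s k)
  disjoint (p , q) = <-irrefl (∈-layer⁻ n (s + k) p) (proj₂ (∈-layers⁻ n s k q))

-- Level h + j falls short of the central coefficient by at most the fraction j²/(h + 1). The crude
-- bound k² for each of the k levels suffices, since k is fixed while h grows.
length-layers : ∀ n k → let h = ⌊ n /2⌋ in
                suc h * (k * centre n) ≤ suc h * length (layers n h k) + k * (k * k) * centre n
length-layers n k = bounded k ≤-refl
  where
  open ≤-Reasoning
  h M : ℕ
  h = ⌊ n /2⌋
  M = centre n
  regroup₁ : ∀ h j m → suc h * (suc j * m) ≡ suc h * m + suc h * (j * m)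
  regroup₁ = solve-∀
  regroup₂ : ∀ h c l i j q m → suc h * c + i * m + (suc h * l + j * q * m) ≡
                               suc h * (c + l) + (i + j * q) * m
  regroup₂ = solve-∀
  -- The number of levels j varies while the loss k² per level stays fixed, so that the induction
  -- closes.
  bounded : ∀ j → j ≤ k → suc h * (j * M) ≤ suc h * length (layers n h j) + j * (k * k) * M
  bounded zero    _   = ≤-reflexive (sym (+-identityʳ _))
  bounded (suc j) j<k = begin
    suc h * (suc j * M)
      ≡⟨ regroup₁ h j M ⟩
    suc h * M + suc h * (j * M)
      ≤⟨ +-mono-≤ (C-near-centre n j) (bounded j (<⇒≤ j<k)) ⟩
    suc h * (n C (h + j)) + j * j * M + (suc h * length (layers n h j) + j * (k * k) * M)
      ≡⟨ regroup₂ h (n C (h + j)) _ (j * j) j (k * k) M ⟩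
    suc h * (n C (h + j) + length (layers n h j)) + (j * j + j * (k * k)) * M
      ≤⟨ +-monoʳ-≤ (suc h * (n C (h + j) + length (layers n h j)))
           (*-monoˡ-≤ M (+-monoˡ-≤ (j * (k * k)) (*-mono-≤ (<⇒≤ j<k) (<⇒≤ j<k)))) ⟩
    suc h * (n C (h + j) + length (layers n h j)) + suc j * (k * k) * M
      ≡⟨ cong (λ l → suc h * l + suc j * (k * k) * M)
           (trans (length-++ (layer n (h + j))) (cong (_+ length (layers n h j)) (length-layer n (h + j)))) ⟨
    suc h * length (layers n h (suc j)) + suc j * (k * k) * M ∎

-- Embeddings of posets

-- Keeping the sets apart from their membership proofs lets the same map be moved from one family to
-- another, as `restrict` does.
record Embedding (P : FinitePoset) {n : ℕ} (𝓕 : Pred (Subset n) 0ℓ) : Set where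
  open FinitePoset P using (Carrier; _≈_) renaming (_≤_ to _⊑_)
  field
    image     : Carrier → Subset n
    member    : ∀ x → 𝓕 (image x)
    injective : ∀ {x y} → image x ≡ image y → x ≈ y
    monotone  : ∀ {x y} → x ⊑ y → image x ⊆ image y

open Embedding

module _ {P : FinitePoset} {n : ℕ} where

  isFree⁺ : {𝓕 : Pred (Subset n) 0ℓ} → ¬ Embedding P 𝓕 → P IsFree 𝓕
  isFree⁺ ¬emb (f , f-inj , f-mono) = ¬emb record
    { image = proj₁ ∘ f ; member = proj₂ ∘ f ; injective = f-inj ; monotone = f-mono }

  isFree⁻ : {𝓕 : Pred (Subset n) 0ℓ} → P IsFree 𝓕 → ¬ Embedding P 𝓕
  isFree⁻ free f = free ((λ x → image f x , member f x) , injective f , monotone f)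

  restrict : {𝓕 𝓖 : Pred (Subset n) 0ℓ} (f : Embedding P 𝓕) → (∀ x → 𝓖 (image f x)) → Embedding P 𝓖
  restrict f member′ = record
    { image = image f ; member = member′ ; injective = injective f ; monotone = monotone f }

dual-embedding⁺ : ∀ {P n} {𝓕 𝓖 : Pred (Subset n) 0ℓ} (f : Embedding P 𝓕) →
                  (∀ x → 𝓖 (∁ (image f x))) → Embedding (dual P) 𝓖
dual-embedding⁺ f member′ = record
  { image     = ∁ ∘ image f
  ; member    = member′
  ; injective = injective f ∘ ∁-injective
  ; monotone  = p⊆q⇒∁p⊇∁q ∘ monotone f
  }

dual-embedding⁻ : ∀ {P n} {𝓕 𝓖 : Pred (Subset n) 0ℓ} (f : Embedding (dual P) 𝓕) →
                  (∀ x → 𝓖 (∁ (image f x))) → Embedding P 𝓖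
dual-embedding⁻ f member′ = record
  { image     = ∁ ∘ image f
  ; member    = member′
  ; injective = injective f ∘ ∁-injective
  ; monotone  = p⊆q⇒∁p⊇∁q ∘ monotone f
  }

++-mono-⊆ : ∀ {m n} {A A′ : Subset m} {B B′ : Subset n} → A ⊆ A′ → B ⊆ B′ → (A Vec.++ B) ⊆ (A′ Vec.++ B′)
++-mono-⊆ {A = []}         {[]}     A⊆A′ B⊆B′ = B⊆B′
++-mono-⊆ {A = inside ∷ A} {_ ∷ A′} A⊆A′ B⊆B′ here with A⊆A′ here
... | here = here
++-mono-⊆ {A = a ∷ A} {_ ∷ A′} A⊆A′ B⊆B′ (there x∈) = there (++-mono-⊆ A⊆A′′ B⊆B′ x∈)
  where
  A⊆A′′ : A ⊆ A′
  A⊆A′′ y∈ with A⊆A′ (there y∈)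
  ... | there y∈′ = y∈′

∣++∣ : ∀ {m n} (A : Subset m) (B : Subset n) → ∣ A Vec.++ B ∣ ≡ ∣ A ∣ + ∣ B ∣
∣++∣ []            B = refl
∣++∣ (inside ∷ A)  B = cong suc (∣++∣ A B)
∣++∣ (outside ∷ A) B = ∣++∣ A B

-- Copies of the glued poset and its value of e

module _ (P₁ P₂ : FinitePoset)
         {0₁ : FinitePoset.Carrier P₁} (0₁-min : Minimum (FinitePoset._≤_ P₁) 0₁)
         {0₂ : FinitePoset.Carrier P₂} (0₂-min : Minimum (FinitePoset._≤_ P₂) 0₂) where
  private
    module P₁ = FinitePoset P₁
    module P₂ = FinitePoset P₂
    P : FinitePoset
    P = glue P₁ (dual P₂) 0₁-min 0₂-min
  open Glue P₁ (dual P₂) 0₁-min 0₂-min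
    using (P≈; Q≈; b≈t; t≈b; _≼_; PP; QQ; QP; PQ; ≤ᵍ⇒≼; ≼⇒≤ᵍ) renaming (_≈_ to _≈ᵍ_)

  -- Images under `g` lie below the common set and images under `f` above it. A set that is an image
  -- under both is therefore the common one, and its two preimages are exactly the identified
  -- elements.
  glue-embedding⁺ : ∀ {n} {𝓕 : Pred (Subset n) 0ℓ} (f : Embedding P₁ 𝓕) (g : Embedding (dual P₂) 𝓕) →
                    image f 0₁ ≡ image g 0₂ → Embedding P 𝓕
  glue-embedding⁺ {n} f g eq = record
    { image     = im
    ; member    = λ where (inj₁ x) → member f x
                          (inj₂ y) → member g y
    ; injective = im-injective
    ; monotone  = mono ∘ ≤ᵍ⇒≼
    }
    where
    im : P₁.Carrier ⊎ P₂.Carrier → Subset n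
    im (inj₁ x) = image f x
    im (inj₂ y) = image g y

    below : ∀ x y → image g y ⊆ image f x
    below x y = ⊆-trans (monotone g (0₂-min y)) (⊆-trans (⊆-reflexive (sym eq)) (monotone f (0₁-min x)))

    cross : ∀ {x y} → image f x ≡ image g y → (x P₁.≈ 0₁) × (y P₂.≈ 0₂)
    cross {x} {y} p = injective f fx≡f0 , injective g (trans (sym p) (trans fx≡f0 eq))
      where
      fx≡f0 : image f x ≡ image f 0₁
      fx≡f0 = ⊆-antisym (⊆-trans (⊆-reflexive p) (below 0₁ y)) (monotone f (0₁-min x))

    im-injective : ∀ {u v} → im u ≡ im v → u ≈ᵍ v
    im-injective {inj₁ _} {inj₁ _} p = P≈ (injective f p)
    im-injective {inj₂ _} {inj₂ _} p = Q≈ (injective g p)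
    im-injective {inj₁ _} {inj₂ _} p = let x≈ , y≈ = cross p in b≈t x≈ y≈
    im-injective {inj₂ _} {inj₁ _} p = let x≈ , y≈ = cross (sym p) in t≈b x≈ y≈

    mono : ∀ {u v} → u ≼ v → im u ⊆ im v
    mono (PP p)   = monotone f p
    mono (QQ q)   = monotone g q
    mono (QP {x} {y}) = below x y
    mono (PQ {x} {y} p q) = ⊆-trans (monotone f p) (⊆-trans (⊆-reflexive eq) (monotone g q))

  glue-embedding⁻₁ : ∀ {n} {𝓕 : Pred (Subset n) 0ℓ} → Embedding P 𝓕 → Embedding P₁ 𝓕
  glue-embedding⁻₁ f = record
    { image     = image f ∘ inj₁
    ; member    = member f ∘ inj₁
    ; injective = λ p → case-P≈ (injective f p)
    ; monotone  = λ x≤y → monotone f (≼⇒≤ᵍ (PP x≤y))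
    }
    where
    case-P≈ : ∀ {x y} → inj₁ x ≈ᵍ inj₁ y → x P₁.≈ y
    case-P≈ (P≈ p) = p

  glue-embedding⁻₂ : ∀ {n} {𝓕 : Pred (Subset n) 0ℓ} → Embedding P 𝓕 → Embedding (dual P₂) 𝓕
  glue-embedding⁻₂ f = record
    { image     = image f ∘ inj₂
    ; member    = member f ∘ inj₂
    ; injective = λ p → case-Q≈ (injective f p)
    ; monotone  = λ x≤y → monotone f (≼⇒≤ᵍ (QQ x≤y))
    }
    where
    case-Q≈ : ∀ {x y} → inj₂ x ≈ᵍ inj₂ y → x P₂.≈ y
    case-Q≈ (Q≈ q) = q

  -- A copy of P in e₁ + e₂ levels is cut at its glued element. If that lies at least e₂ levels
  -- above the lowest one, only e₁ levels are left for the copy of P₁ above it; otherwise the copy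
  -- of the dual of P₂ below it fits into e₂ levels. Conversely, a copy of P₁ in e₁ + 1 levels and
  -- one of the dual of P₂ in e₂ + 1 levels can share a level, so together they occupy only e₁ + e₂
  -- + 1.
  isE-glue : ∀ {e₁ e₂} → IsE P₁ e₁ → IsE P₂ e₂ → IsE P (e₁ + e₂)
  isE-glue {e₁} {e₂} (free₁ , largest₁) (free₂ , largest₂) =
    (λ n s → isFree⁺ (free n s)) , λ k free-k → ≮⇒≥ (bounded k free-k)
    where
    free : ∀ n s → ¬ Embedding P (Levels n s (e₁ + e₂))
    free n s f with (s ℤ.+ + e₂) ℤ.≤? + ∣ image f (inj₁ 0₁) ∣
    ... | yes s+e₂≤a = isFree⁻ (free₁ n (+ a)) (restrict (glue-embedding⁻₁ f) λ x →
          ℤ.+≤+ (p⊆q⇒∣p∣≤∣q∣ (monotone f (≼⇒≤ᵍ (PP (0₁-min x)))))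
        , ℤ.<-≤-trans (proj₂ (member f (inj₁ x))) (begin
            s ℤ.+ + (e₁ + e₂)    ≡⟨ cong (λ m → s ℤ.+ + m) (+-comm e₁ e₂) ⟩
            s ℤ.+ + (e₂ + e₁)    ≡⟨ ℤ.+-assoc s (+ e₂) (+ e₁) ⟨
            s ℤ.+ + e₂ ℤ.+ + e₁  ≤⟨ ℤ.+-monoˡ-≤ (+ e₁) s+e₂≤a ⟩
            + a ℤ.+ + e₁         ∎))
      where
      open ℤ.≤-Reasoning
      a : ℕ
      a = ∣ image f (inj₁ 0₁) ∣
    ... | no s+e₂≰a = isFree⁻ (free₂ n (+ ∣ ∁ A ∣)) (dual-embedding⁻ {P₂} (glue-embedding⁻₂ f) λ y →
          ℤ.+≤+ (p⊆q⇒∣p∣≤∣q∣ (p⊆q⇒∁p⊇∁q (monotone f (≼⇒≤ᵍ (QP {0₁} {y})))))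
        , ℤ.+<+ (complement (image f (inj₂ y)) (proj₁ (member f (inj₂ y)))))
      where
      A : Subset n
      A = image f (inj₁ 0₁)
      complement : ∀ B → s ℤ.≤ + ∣ B ∣ → ∣ ∁ B ∣ < ∣ ∁ A ∣ + e₂
      complement B s≤b = +-cancelˡ-< ∣ B ∣ _ _ (begin-strict
        ∣ B ∣ + ∣ ∁ B ∣          ≡⟨ trans (∣A∣+∣∁A∣≡n B) (sym (∣A∣+∣∁A∣≡n A)) ⟩
        ∣ A ∣ + ∣ ∁ A ∣          <⟨ +-monoˡ-< ∣ ∁ A ∣ (ℤ.drop‿+<+ (ℤ.<-≤-trans (ℤ.≰⇒> s+e₂≰a) (ℤ.+-monoˡ-≤ (+ e₂) s≤b))) ⟩
        ∣ B ∣ + e₂ + ∣ ∁ A ∣     ≡⟨ trans (+-assoc ∣ B ∣ e₂ _) (cong (λ m → ∣ B ∣ + m) (+-comm e₂ ∣ ∁ A ∣)) ⟩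
        ∣ B ∣ + (∣ ∁ A ∣ + e₂)   ∎)
        where open ≤-Reasoning

    bounded : ∀ k → (∀ n s → P IsFree Levels n s k) → ¬ e₁ + e₂ < k
    bounded k free-k e₁+e₂<k =
      -- The two copies are available only by contradiction: maximality of e₁ refutes freeness of
      -- all e₁ + 1 consecutive levels, and trying to prove that freeness supplies `f`; likewise `g`
      -- for e₂.
      1+n≰n (largest₁ (suc e₁) λ n₁ s₁ → isFree⁺ λ f →
      1+n≰n (largest₂ (suc e₂) λ n₂ s₂ → isFree⁺ λ g →
      isFree⁻ (free-k (n₁ + n₂) _) (stack f g)))
      where
      open ≤-Reasoning

      -- In the product of the two cubes, move the first copy by ∁ B and the
      -- second, turned upside down, by A: they then meet in A ++ ∁ B.
      stack : ∀ {n₁ s₁ n₂ s₂} (f : Embedding P₁ (Levels n₁ s₁ (suc e₁))) (g : Embedding P₂ (Levels n₂ s₂ (suc e₂))) →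
              Embedding P (Levels (n₁ + n₂) (+ (∣ image f 0₁ ∣ + ∣ ∁ (image g 0₂) ∣) ℤ.- + e₂) k)
      stack f g = glue-embedding⁺
        record
          { image     = λ x → image f x Vec.++ ∁ B
          ; member    = λ x → levels⁺ (image f x Vec.++ ∁ B) (subst InLevels (sym (∣++∣ (image f x) (∁ B))) (upper x))
          ; injective = injective f ∘ ++-injectiveˡ _ _
          ; monotone  = λ x≤y → ++-mono-⊆ (monotone f x≤y) ⊆-refl
          }
        record
          { image     = λ y → A Vec.++ ∁ (image g y)
          ; member    = λ y → levels⁺ (A Vec.++ ∁ (image g y)) (subst InLevels (sym (∣++∣ A (∁ (image g y)))) (lower y))
          ; injective = injective g ∘ ∁-injective ∘ ++-injectiveʳ A A
          ; monotone  = λ x≤y → ++-mono-⊆ {A = A} ⊆-refl (p⊆q⇒∁p⊇∁q (monotone g x≤y))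
          }
        refl
        where
        A = image f 0₁
        B = image g 0₂
        a b : ℕ
        a = ∣ A ∣
        b = ∣ ∁ B ∣
        -- The window begins e₂ levels below the shared set, the lowest that the inverted copy of P₂
        -- can reach, while the copy of P₁ reaches at most e₁ levels above it. Adding e₂ to the size
        -- avoids subtraction in ℕ.
        InLevels : ℕ → Set
        InLevels c = a + b ≤ c + e₂ × c + e₂ < a + b + k

        levels⁺ : ∀ X → InLevels ∣ X ∣ → Levels _ (+ (a + b) ℤ.- + e₂) k X
        levels⁺ X (l , u) =
            subst (+ (a + b) ℤ.- + e₂ ℤ.≤_) (cancel (+ ∣ X ∣) (+ e₂)) (ℤ.+-monoˡ-≤ (ℤ.- + e₂) (ℤ.+≤+ l))
          , subst₂ ℤ._<_ (cancel (+ ∣ X ∣) (+ e₂)) (swap (+ (a + b)) (+ k) (+ e₂)) (ℤ.+-monoˡ-< (ℤ.- + e₂) (ℤ.+<+ u))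
          where
          cancel : ∀ i j → i ℤ.+ j ℤ.- j ≡ i
          cancel = ℤ.solve-∀
          swap : ∀ i j l → i ℤ.+ j ℤ.- l ≡ i ℤ.- l ℤ.+ j
          swap = ℤ.solve-∀

        spread : ∀ {n s e} (X Y : Subset n) → Levels n s (suc e) X → Levels n s (suc e) Y → ∣ Y ∣ ≤ ∣ X ∣ + e
        spread {e = e} X Y (s≤x , _) (_ , y<s+e) = s≤s⁻¹ (≤-trans
          (ℤ.drop‿+<+ (ℤ.<-≤-trans y<s+e (ℤ.+-monoˡ-≤ (+ suc e) s≤x))) (≤-reflexive (+-suc ∣ X ∣ e)))

        upper : ∀ x → InLevels (∣ image f x ∣ + b)
        upper x = ≤-trans (+-monoˡ-≤ b (p⊆q⇒∣p∣≤∣q∣ (monotone f (0₁-min x)))) (m≤m+n _ e₂) , (begin-strict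
          ∣ image f x ∣ + b + e₂    ≤⟨ +-monoˡ-≤ e₂ (+-monoˡ-≤ b (spread A (image f x) (member f 0₁) (member f x))) ⟩
          a + e₁ + b + e₂           ≡⟨ regroup a e₁ b e₂ ⟩
          a + b + (e₁ + e₂)         <⟨ +-monoʳ-< (a + b) e₁+e₂<k ⟩
          a + b + k                 ∎)
          where
          regroup : ∀ a e b d → a + e + b + d ≡ a + b + (e + d)
          regroup = solve-∀

        lower : ∀ y → InLevels (a + ∣ ∁ (image g y) ∣)
        lower y = (begin
          a + b                             ≤⟨ +-monoʳ-≤ a (+-cancelˡ-≤ ∣ B ∣ _ _ complement) ⟩
          a + (∣ ∁ (image g y) ∣ + e₂)      ≡⟨ +-assoc a _ e₂ ⟨
          a + ∣ ∁ (image g y) ∣ + e₂        ∎) , (begin-strict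
          a + ∣ ∁ (image g y) ∣ + e₂        ≤⟨ +-monoˡ-≤ e₂ (+-monoʳ-≤ a (p⊆q⇒∣p∣≤∣q∣ (p⊆q⇒∁p⊇∁q (monotone g (0₂-min y))))) ⟩
          a + b + e₂                        <⟨ +-monoʳ-< (a + b) (≤-<-trans (m≤n+m e₂ e₁) e₁+e₂<k) ⟩
          a + b + k                         ∎)
          where
          Y = image g y
          regroup : ∀ b e y → b + e + y ≡ b + (y + e)
          regroup = solve-∀
          complement : ∣ B ∣ + b ≤ ∣ B ∣ + (∣ ∁ Y ∣ + e₂)
          complement = begin
            ∣ B ∣ + ∣ ∁ B ∣          ≡⟨ trans (∣A∣+∣∁A∣≡n B) (sym (∣A∣+∣∁A∣≡n Y)) ⟩
            ∣ Y ∣ + ∣ ∁ Y ∣          ≤⟨ +-monoˡ-≤ ∣ ∁ Y ∣ (spread B Y (member g 0₂) (member g y)) ⟩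
            ∣ B ∣ + e₂ + ∣ ∁ Y ∣     ≡⟨ regroup (∣ B ∣) e₂ (∣ ∁ Y ∣) ⟩
            ∣ B ∣ + (∣ ∁ Y ∣ + e₂)   ∎

-- Deciding embeddings; existence of La(n, P)

_≟ˢ_ : ∀ {n} → DecidableEquality (Subset n)
_≟ˢ_ = ≡-dec Bool._≟_

_∈?_ : ∀ {n} (A : Subset n) xs → Dec (A ∈ xs)
_∈?_ = mem? _≟ˢ_

-- With the least element as `x₀`, this says that `A` is the bottom of a copy, the property by which
-- the middle family is split.
EmbeddingAt : (P : FinitePoset) → ∀ {n} → List (Subset n) → FinitePoset.Carrier P → Subset n → Set
EmbeddingAt P xs x₀ A = Σ[ f ∈ Embedding P (_∈ xs) ] image f x₀ ≡ A

module _ (P : FinitePoset) {n : ℕ} (xs : List (Subset n)) where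
  private
    module P = FinitePoset P
    m : ℕ
    m = length P.elements

    index : P.Carrier → Fin m
    index = Any.index ∘ P.enumerates

    element : Fin m → P.Carrier
    element = lookup P.elements

    ≈-element : ∀ x → x P.≈ element (index x)
    ≈-element = lookup-index ∘ P.enumerates

    -- A map from P to xs is determined by its values on the enumerated
    -- elements, and these values are coded by a single number.
    IsCode : P.Carrier → Subset n → Fin (length xs ^ m) → Set
    IsCode x₀ A c =
      (∀ i j → g i ≡ g j → element i P.≈ element j) ×
      (∀ i j → element i P.≤ element j → g i ⊆ g j) ×
      g (index x₀) ≡ A
      where
      g : Fin m → Subset n
      g = lookup xs ∘ finToFun c

    isCode? : ∀ x₀ A → Decidable (IsCode x₀ A)
    isCode? x₀ A c =
      Fin.all? (λ i → Fin.all? λ j → (g i ≟ˢ g j) →-dec (element i P.≟ element j)) ×-dec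
      Fin.all? (λ i → Fin.all? λ j → (element i P.≤? element j) →-dec (g i ⊆? g j)) ×-dec
      (g (index x₀) ≟ˢ A)
      where
      g : Fin m → Subset n
      g = lookup xs ∘ finToFun c

    decode : ∀ {x₀ A} → ∃ (IsCode x₀ A) → EmbeddingAt P xs x₀ A
    decode (c , inj , mono , at) = record
      { image     = g ∘ index
      ; member    = λ x → ∈-lookup (finToFun c (index x))
      ; injective = λ {x} {y} p → P.Eq.trans (≈-element x) (P.Eq.trans (inj _ _ p) (P.Eq.sym (≈-element y)))
      ; monotone  = λ {x} {y} x≤y → mono _ _
          (P.trans (P.reflexive (P.Eq.sym (≈-element x))) (P.trans x≤y (P.reflexive (≈-element y))))
      } , at
      where
      g : Fin m → Subset n
      g = lookup xs ∘ finToFun c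

    encode : ∀ {x₀ A} → EmbeddingAt P xs x₀ A → ∃ (IsCode x₀ A)
    encode {x₀} (f , at) = funToFin code
      , (λ i j p → injective f (trans (sym (g≡ i)) (trans p (g≡ j))))
      , (λ i j i≤j → ⊆-trans (⊆-reflexive (g≡ i)) (⊆-trans (monotone f i≤j) (⊆-reflexive (sym (g≡ j)))))
      , trans (g≡ (index x₀)) (trans (≈⇒image≡ (P.Eq.sym (≈-element x₀))) at)
      where
      code : Fin m → Fin (length xs)
      code = Any.index ∘ member f ∘ element
      g≡ : ∀ i → lookup xs (finToFun (funToFin code) i) ≡ image f (element i)
      g≡ i = trans (cong (lookup xs) (Fin.finToFun-funToFin code i)) (sym (lookup-index (member f (element i))))
      ≈⇒image≡ : ∀ {x y} → x P.≈ y → image f x ≡ image f y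
      ≈⇒image≡ x≈y = ⊆-antisym (monotone f (P.reflexive x≈y)) (monotone f (P.reflexive (P.Eq.sym x≈y)))

  embeddingAt? : ∀ x₀ → Decidable (EmbeddingAt P xs x₀)
  embeddingAt? x₀ A = map′ decode encode (Fin.any? (isCode? x₀ A))

  embedding? : Dec (Embedding P (_∈ xs))
  embedding? = map′ (λ any → proj₁ (proj₂ (Any.satisfied any)))
                    (λ f → Any.map (λ eq → f , eq) (member f P.nonempty))
                    (Any.any? (embeddingAt? P.nonempty) xs)

module _ {a} {A : Set a} where

  AllPairs-anti-Sublist : ∀ {r} {R : A → A → Set r} {xs ys} → xs Sublist.⊆ ys → AllPairs R ys → AllPairs R xs
  AllPairs-anti-Sublist []           []        = []
  AllPairs-anti-Sublist (_ ∷ʳ p)     (_ ∷ ys)  = AllPairs-anti-Sublist p ys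
  AllPairs-anti-Sublist (refl ∷ p)   (y ∷ ys)  = Sublist.All-resp-⊆ p y ∷ AllPairs-anti-Sublist p ys

  anySublist? : ∀ {q} {Q : List A → Set q} → Decidable Q → ∀ xs → Dec (∃[ ys ] ys Sublist.⊆ xs × Q ys)
  anySublist? Q? [] = map′ (λ q → [] , [] , q) (λ { ([] , [] , q) → q }) (Q? [])
  anySublist? {Q = Q} Q? (x ∷ xs) with anySublist? (Q? ∘ (x ∷_)) xs
  ... | yes (ys , ys⊆xs , q) = yes (x ∷ ys , refl ∷ ys⊆xs , q)
  ... | no ¬with = map′ (λ (ys , ys⊆xs , q) → ys , x ∷ʳ ys⊆xs , q) without (anySublist? Q? xs)
    where
    without : ∃[ ys ] ys Sublist.⊆ x ∷ xs × Q ys → ∃[ ys ] ys Sublist.⊆ xs × Q ys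
    without (ys , .x ∷ʳ ys⊆xs , q)       = ys , ys⊆xs , q
    without (_ ∷ ys , refl ∷ ys⊆xs , q) = contradiction (ys , ys⊆xs , q) ¬with

largest : ∀ {q} {Q : ℕ → Set q} → Decidable Q → Q 0 → ∀ b → (∀ k → Q k → k ≤ b) →
          ∃[ m ] Q m × (∀ k → Q k → k ≤ m)
largest Q? q₀ zero    bound = 0 , q₀ , bound
largest Q? q₀ (suc b) bound with Q? (suc b)
... | yes q = suc b , q , bound
... | no ¬q = largest Q? q₀ b λ k q → s≤s⁻¹ (≤∧≢⇒< (bound k q) λ { refl → ¬q q })

module _ (P : FinitePoset) (n : ℕ) where
  private
    FreeOfSize : ℕ → List (Subset n) → Set
    FreeOfSize k xs = ¬ Embedding P (_∈ xs) × length xs ≡ k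

    FreeFamily : ℕ → Set
    FreeFamily k = ∃[ 𝓕 ] P IsFree Mem {n} 𝓕 × size 𝓕 ≡ k

    toFamily : ∀ {k} → ∃[ xs ] xs Sublist.⊆ subsets n × FreeOfSize k xs → FreeFamily k
    toFamily (xs , xs⊆ , free , eq) =
      record { members = xs ; unique = AllPairs-anti-Sublist xs⊆ (subsets-unique n) } , isFree⁺ free , eq

    -- A family may list its members in any order. Filtering `subsets n` puts them into one standard
    -- order, and two lists without repetitions and with the same members have the same length, so
    -- searching the sublists of `subsets n` misses no size.
    fromFamily : ∀ {k} → FreeFamily k → ∃[ xs ] xs Sublist.⊆ subsets n × FreeOfSize k xs
    fromFamily (𝓕 , free , refl) = xs , Sublist.filter-⊆ (_∈? members) (subsets n) ,
      (λ f → isFree⁻ free (restrict f (λ x → ⊆members (member f x)))) ,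
      ≤-antisym (length-mono-⊆ (Unique.filter⁺ (_∈? members) (subsets-unique n)) ⊆members)
                (length-mono-⊆ unique λ A∈ → ∈-filter⁺ (_∈? members) (∈-subsets _) A∈)
      where
      open Family 𝓕 using (members; unique)
      xs : List (Subset n)
      xs = filter (_∈? members) (subsets n)
      ⊆members : ∀ {A} → A ∈ xs → A ∈ members
      ⊆members = proj₂ ∘ ∈-filter⁻ (_∈? members) {xs = subsets n}

    freeFamily? : Decidable FreeFamily
    freeFamily? k = map′ toFamily fromFamily
      (anySublist? (λ xs → ¬? (embedding? P xs) ×-dec (length xs ≟ k)) (subsets n))

  La-exists : ∃ (IsLa P n)
  La-exists = largest freeFamily?
    (record { members = [] ; unique = [] } ,
     isFree⁺ {P} (λ f → case-[] (member f (FinitePoset.nonempty P))) , refl)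
    (length (subsets n))
    λ { _ (𝓕 , _ , refl) → length-mono-⊆ (Family.unique 𝓕) λ _ → ∈-subsets _ }
    where
    case-[] : ∀ {A : Subset n} → ¬ A ∈ []
    case-[] ()

-- Fractions

toℚᵘ-/ : ∀ a d → toℚᵘ (+ a / suc d) ℚᵘ.≃ mkℚᵘ (+ a) d
toℚᵘ-/ a d = ℚ.toℚᵘ-fromℚᵘ (mkℚᵘ (+ a) d)

/-mono-≤ : ∀ a b c d .{{_ : NonZero c}} .{{_ : NonZero d}} → a * d ≤ b * c → + a / c ℚ.≤ + b / d
/-mono-≤ a b c@(suc c-1) d@(suc d-1) ad≤bc = ℚ.toℚᵘ-cancel-≤
  (ℚᵘ.≤-respˡ-≃ (ℚᵘ.≃-sym (toℚᵘ-/ a c-1))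
  (ℚᵘ.≤-respʳ-≃ (ℚᵘ.≃-sym (toℚᵘ-/ b d-1))
  (ℚᵘ.*≤* (subst₂ ℤ._≤_ (ℤ.pos-* a d) (ℤ.pos-* b c) (ℤ.+≤+ ad≤bc)))))

/-cancel-≤ : ∀ a b c d .{{_ : NonZero c}} .{{_ : NonZero d}} → + a / c ℚ.≤ + b / d → a * d ≤ b * c
/-cancel-≤ a b c@(suc c-1) d@(suc d-1) a/c≤b/d
  with ℚᵘ.≤-respˡ-≃ (toℚᵘ-/ a c-1) (ℚᵘ.≤-respʳ-≃ (toℚᵘ-/ b d-1) (ℚ.toℚᵘ-mono-≤ a/c≤b/d))
... | ℚᵘ.*≤* ad≤bc = ℤ.drop‿+≤+ (subst₂ ℤ._≤_ (sym (ℤ.pos-* a d)) (sym (ℤ.pos-* b c)) ad≤bc)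

/-mono-< : ∀ a b c d .{{_ : NonZero c}} .{{_ : NonZero d}} → a * d < b * c → + a / c ℚ.< + b / d
/-mono-< a b c@(suc c-1) d@(suc d-1) ad<bc = ℚ.toℚᵘ-cancel-<
  (ℚᵘ.<-respˡ-≃ (ℚᵘ.≃-sym (toℚᵘ-/ a c-1))
  (ℚᵘ.<-respʳ-≃ (ℚᵘ.≃-sym (toℚᵘ-/ b d-1))
  (ℚᵘ.*<* (subst₂ ℤ._<_ (ℤ.pos-* a d) (ℤ.pos-* b c) (ℤ.+<+ ad<bc)))))

/-+-/ : ∀ a b c d .{{_ : NonZero c}} .{{_ : NonZero d}} →
        (+ a / c) ℚ.+ (+ b / d) ≡ (+ (a * d + b * c) / (c * d)) {{m*n≢0 c d}}
/-+-/ a b c@(suc c-1) d@(suc d-1) = ℚ.toℚᵘ-injective (begin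
  toℚᵘ ((+ a / c) ℚ.+ (+ b / d))                 ≈⟨ ℚ.toℚᵘ-homo-+ (+ a / c) (+ b / d) ⟩
  toℚᵘ (+ a / c) ℚᵘ.+ toℚᵘ (+ b / d)             ≈⟨ ℚᵘ.+-cong (toℚᵘ-/ a c-1) (toℚᵘ-/ b d-1) ⟩
  mkℚᵘ (+ a) c-1 ℚᵘ.+ mkℚᵘ (+ b) d-1             ≡⟨ cong (λ i → mkℚᵘ i (pred (c * d))) (cong₂ ℤ._+_ (ℤ.pos-* a d) (ℤ.pos-* b c)) ⟨
  mkℚᵘ (+ (a * d + b * c)) (pred (c * d))        ≈⟨ toℚᵘ-/ (a * d + b * c) (pred (c * d)) ⟨
  toℚᵘ (+ (a * d + b * c) / (c * d))             ∎)
  where open ℚᵘ.≃-Reasoning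

/-*-/ : ∀ a b c d .{{_ : NonZero c}} .{{_ : NonZero d}} →
        (+ a / c) ℚ.* (+ b / d) ≡ (+ (a * b) / (c * d)) {{m*n≢0 c d}}
/-*-/ a b c@(suc c-1) d@(suc d-1) = ℚ.toℚᵘ-injective (begin
  toℚᵘ ((+ a / c) ℚ.* (+ b / d))                 ≈⟨ ℚ.toℚᵘ-homo-* (+ a / c) (+ b / d) ⟩
  toℚᵘ (+ a / c) ℚᵘ.* toℚᵘ (+ b / d)             ≈⟨ ℚᵘ.*-cong (toℚᵘ-/ a c-1) (toℚᵘ-/ b d-1) ⟩
  mkℚᵘ (+ a) c-1 ℚᵘ.* mkℚᵘ (+ b) d-1             ≡⟨ cong (λ i → mkℚᵘ i (pred (c * d))) (ℤ.pos-* a b) ⟨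
  mkℚᵘ (+ (a * b)) (pred (c * d))                ≈⟨ toℚᵘ-/ (a * b) (pred (c * d)) ⟨
  toℚᵘ (+ (a * b) / (c * d))                     ∎)
  where open ℚᵘ.≃-Reasoning

/-<-3/4* : ∀ k n → 4 * k < 3 * n → fromℕ k ℚ.< (+ 3 / 4) ℚ.* fromℕ n
/-<-3/4* k n 4k<3n = subst (fromℕ k ℚ.<_) (sym (/-*-/ 3 n 4 1))
  (/-mono-< k (3 * n) 1 4 (subst₂ _<_ (*-comm 4 k) (sym (*-identityʳ _)) 4k<3n))

-- A positive rational has numerator at least 1. Replacing ε by 1/q turns the final estimates into
-- inequalities between naturals.
1/↧≤ : ∀ {ε} → 0ℚ ℚ.< ε → + 1 / ↧ₙ ε ℚ.≤ ε
1/↧≤ {ε@(mkℚ +[1+ p ] _ _)} _ = subst (+ 1 / ↧ₙ ε ℚ.≤_) (ℚ.↥p/↧p≡p ε)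
  (/-mono-≤ 1 (suc p) (↧ₙ ε) (↧ₙ ε) (*-monoˡ-≤ (↧ₙ ε) (s≤s (z≤n {p}))))
1/↧≤ {mkℚ +0 _ _}       (ℚ.*<* (ℤ.+<+ ()))
1/↧≤ {mkℚ -[1+ _ ] _ _} (ℚ.*<* ())

p<r+q⇒p-q<r : ∀ p q r → p ℚ.< r ℚ.+ q → p ℚ.- q ℚ.< r
p<r+q⇒p-q<r p q r p<r+q = subst (p ℚ.- q ℚ.<_) cancel (ℚ.+-monoˡ-< (ℚ.- q) p<r+q)
  where
  cancel : r ℚ.+ q ℚ.- q ≡ r
  cancel = trans (ℚ.+-assoc r q (ℚ.- q)) (trans (cong (r ℚ.+_) (ℚ.+-inverseʳ q)) (ℚ.+-identityʳ r))

-- With d = 5q, four error units amount to 4/(5q); the fifth unit, positive since `c` is, makes the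
-- comparison with 1/q ≤ ε strict.
∣/-fromℕ∣<ε : ∀ a c e ε .{{c≢0 : NonZero c}} → 0ℚ ℚ.< ε →
              let d = 5 * ↧ₙ ε in
              d * a ≤ (d * e + 4) * c → d * (e * c) ≤ d * a + 4 * c →
              ℚ.∣ (+ a / c) ℚ.- fromℕ e ∣ ℚ.< ε
∣/-fromℕ∣<ε a c e ε {{c≢0}} 0<ε upper lower with ℚ.∣p∣≡p∨∣p∣≡-p ((+ a / c) ℚ.- fromℕ e)
... | inj₁ eq = subst (ℚ._< ε) (sym eq) (p<r+q⇒p-q<r (+ a / c) (fromℕ e) ε
        (ℚ.<-≤-trans a/c<1/q+e (ℚ.+-monoˡ-≤ (fromℕ e) (1/↧≤ 0<ε))))
  where
  open ≤-Reasoning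
  q = ↧ₙ ε
  regroup₁ : ∀ q a → 5 * (a * (q * 1)) ≡ 5 * q * a
  regroup₁ = solve-∀
  regroup₂ : ∀ q e c → (5 * q * e + 4) * c + c ≡ 5 * ((1 * 1 + e * q) * c)
  regroup₂ = solve-∀
  a/c<1/q+e : + a / c ℚ.< (+ 1 / q) ℚ.+ fromℕ e
  a/c<1/q+e = subst (+ a / c ℚ.<_) (sym (/-+-/ 1 e q 1)) (/-mono-< a (1 * 1 + e * q) c (q * 1) {{c≢0}} {{m*n≢0 q 1}}
    (*-cancelˡ-< 5 _ _ (begin-strict
      5 * (a * (q * 1))               ≡⟨ regroup₁ q a ⟩
      5 * q * a                       ≤⟨ upper ⟩
      (5 * q * e + 4) * c             <⟨ m<m+n _ (>-nonZero⁻¹ c) ⟩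
      (5 * q * e + 4) * c + c         ≡⟨ regroup₂ q e c ⟩
      5 * ((1 * 1 + e * q) * c)       ∎)))
... | inj₂ eq = subst (ℚ._< ε) (sym (trans eq (⁻¹-anti-homo‿- (+ a / c) (fromℕ e)))) (p<r+q⇒p-q<r (fromℕ e) (+ a / c) ε
        (ℚ.<-≤-trans e<1/q+a/c (ℚ.+-monoˡ-≤ (+ a / c) (1/↧≤ 0<ε))))
  where
  open ≤-Reasoning
  q = ↧ₙ ε
  regroup₁ : ∀ q e c → 5 * (e * (q * c)) ≡ 5 * q * (e * c)
  regroup₁ = solve-∀
  regroup₂ : ∀ q a c → 5 * q * a + 4 * c + c ≡ 5 * ((1 * c + a * q) * 1)
  regroup₂ = solve-∀
  e<1/q+a/c : fromℕ e ℚ.< (+ 1 / q) ℚ.+ (+ a / c)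
  e<1/q+a/c = subst (fromℕ e ℚ.<_) (sym (/-+-/ 1 a q c)) (/-mono-< e (1 * c + a * q) 1 (q * c) {{_}} {{m*n≢0 q c}}
    (*-cancelˡ-< 5 _ _ (begin-strict
      5 * (e * (q * c))               ≡⟨ regroup₁ q e c ⟩
      5 * q * (e * c)                 ≤⟨ lower ⟩
      5 * q * a + 4 * c               <⟨ m<m+n _ (>-nonZero⁻¹ c) ⟩
      5 * q * a + 4 * c + c           ≡⟨ regroup₂ q a c ⟩
      5 * ((1 * c + a * q) * 1)       ∎)))

-- The size of a P-free family

centre-nonZero : ∀ n → NonZero (centre n)
centre-nonZero n = C-nonZero (⌊n/2⌋≤n n)

-- No binomial coefficient exceeds the central one, so every member has weight at least
-- 1/`centre n`.
length/centre≤lubell : ∀ {n} (𝓕 : Family n) → (+ size 𝓕 / centre n) {{centre-nonZero n}} ℚ.≤ lubell 𝓕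
length/centre≤lubell {n} 𝓕 = go (Family.members 𝓕)
  where
  open ℚ.≤-Reasoning
  instance
    centre≢0 : NonZero (centre n)
    centre≢0 = centre-nonZero n
  regroup : ∀ l c → suc l * (c * c) ≡ (1 * c + l * c) * c
  regroup = solve-∀
  go : ∀ xs → + length xs / centre n ℚ.≤ foldr (λ A s → weight A ℚ.+ s) 0ℚ xs
  go []       = /-mono-≤ 0 0 (centre n) 1 ≤-refl
  go (A ∷ xs) = begin
    + suc (length xs) / centre n
      ≤⟨ /-mono-≤ (suc (length xs)) (1 * centre n + length xs * centre n) (centre n) (centre n * centre n)
           {{centre≢0}} {{m*n≢0 (centre n) (centre n)}} (≤-reflexive (regroup (length xs) (centre n))) ⟩
    (+ (1 * centre n + length xs * centre n) / (centre n * centre n)) {{m*n≢0 (centre n) (centre n)}}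
      ≡⟨ /-+-/ 1 (length xs) (centre n) (centre n) ⟨
    (+ 1 / centre n) ℚ.+ (+ length xs / centre n)
      ≤⟨ ℚ.+-mono-≤ (/-mono-≤ 1 1 (centre n) (n C ∣ A ∣) {{centre≢0}} {{C-nonZero (∣p∣≤n A)}} (*-monoʳ-≤ 1 (C≤centre n ∣ A ∣))) (go xs) ⟩
    weight A ℚ.+ foldr (λ A s → weight A ℚ.+ s) 0ℚ xs ∎

size≤ : ∀ {n} (𝓕 : Family n) e d .{{_ : NonZero d}} → lubell 𝓕 ℚ.≤ fromℕ e ℚ.+ (+ 1 / d) →
        d * size 𝓕 ≤ (d * e + 1) * centre n
size≤ {n} 𝓕 e d lubell≤ = begin
  d * size 𝓕                             ≡⟨ regroup₁ d (size 𝓕) ⟩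
  size 𝓕 * (1 * d)                       ≤⟨ /-cancel-≤ (size 𝓕) (e * d + 1 * 1) (centre n) (1 * d) {{centre-nonZero n}} {{m*n≢0 1 d}}
                                              (subst (_ ℚ.≤_) (/-+-/ e 1 1 d) (ℚ.≤-trans (length/centre≤lubell 𝓕) lubell≤)) ⟩
  (e * d + 1 * 1) * centre n             ≡⟨ regroup₂ e d (centre n) ⟩
  (d * e + 1) * centre n                 ∎
  where
  open ≤-Reasoning
  regroup₁ : ∀ d s → d * s ≡ s * (1 * d)
  regroup₁ = solve-∀
  regroup₂ : ∀ e d c → (e * d + 1 * 1) * c ≡ (d * e + 1) * c
  regroup₂ = solve-∀

filterFamily : ∀ {n p} {Q : Subset n → Set p} → Decidable Q → Family n → Family n
filterFamily Q? 𝓕 = record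
  { members = filter Q? (Family.members 𝓕) ; unique = Unique.filter⁺ Q? (Family.unique 𝓕) }

complementFamily : ∀ {n} → Family n → Family n
complementFamily 𝓕 = record
  { members = map ∁ (Family.members 𝓕) ; unique = Unique.map⁺ ∁-injective (Family.unique 𝓕) }

-- What lower-L-boundedness with β = 3/4 and ε = 1/d says about sizes, with the denominators
-- cleared.
LubellBound : FinitePoset → ℕ → ℕ → ℕ → Set
LubellBound P e d n = (𝓕 : Family n) → P IsFree Mem 𝓕 → (∀ A → Mem 𝓕 A → 4 * ∣ A ∣ < 3 * n) →
                      d * size 𝓕 ≤ (d * e + 1) * centre n

lubellBound : ∀ {P} (bounded : LowerLBounded P) d .{{_ : NonZero d}} →
              ∃[ N ] ∀ n → N ≤ n → LubellBound P (proj₁ bounded) d n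
lubellBound {P} (e , _ , bounded) d = proj₁ bound , λ n N≤n 𝓕 free small →
  size≤ 𝓕 e d (proj₂ bound n N≤n 𝓕 free λ A A∈ → /-<-3/4* ∣ A ∣ n (small A A∈))
  where
  ¾ : ℚ
  ¾ = + 3 / 4
  bound : ∃[ N ] ∀ n → N ≤ n → (𝓕 : Family n) → P IsFree Mem 𝓕 →
          (∀ A → Mem 𝓕 A → fromℕ ∣ A ∣ ℚ.< ¾ ℚ.* fromℕ n) → lubell 𝓕 ℚ.≤ fromℕ e ℚ.+ (+ 1 / d)
  bound = bounded ¾ (+ 1 / d) (/-mono-< 1 3 2 4 (from-yes (4 <? 6))) (/-mono-< 3 1 4 1 ≤-refl) (/-mono-< 0 1 1 d ≤-refl)

module _ (P₁ P₂ : FinitePoset)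
         {0₁ : FinitePoset.Carrier P₁} (0₁-min : Minimum (FinitePoset._≤_ P₁) 0₁)
         {0₂ : FinitePoset.Carrier P₂} (0₂-min : Minimum (FinitePoset._≤_ P₂) 0₂)
         {e₁ e₂ : ℕ} (d n : ℕ) (400d≤n : 400 * d ≤ n)
         (bound₁ : LubellBound P₁ e₁ d n) (bound₂ : LubellBound P₂ e₂ d n) where
  private
    P : FinitePoset
    P = glue P₁ (dual P₂) 0₁-min 0₂-min

  -- 𝓑 consists of the bottoms of copies of P₁; the other members are P₁-free.
  middle-size≤ : (𝓜 : Family n) → P IsFree Mem 𝓜 →
                 (∀ A → Mem 𝓜 A → n < 4 * ∣ A ∣ × 4 * ∣ A ∣ < 3 * n) →
                 d * size 𝓜 ≤ (d * (e₁ + e₂) + 2) * centre n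
  middle-size≤ 𝓜 free middle = begin
    d * size 𝓜
      ≡⟨ cong (d *_) (length-filter-¬ bottom? members) ⟩
    d * (size 𝓑 + size 𝓤)
      ≡⟨ *-distribˡ-+ d (size 𝓑) (size 𝓤) ⟩
    d * size 𝓑 + d * size 𝓤
      ≡⟨ cong (λ k → d * k + d * size 𝓤) (length-map ∁ (Family.members 𝓑)) ⟨
    d * size (complementFamily 𝓑) + d * size 𝓤
      ≤⟨ +-mono-≤ (bound₂ (complementFamily 𝓑) (isFree⁺ free₂) small₂) (bound₁ 𝓤 (isFree⁺ free₁) small₁) ⟩
    (d * e₂ + 1) * centre n + (d * e₁ + 1) * centre n
      ≡⟨ regroup d e₁ e₂ (centre n) ⟩
    (d * (e₁ + e₂) + 2) * centre n ∎
    where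
    open ≤-Reasoning
    open Family 𝓜 using (members)
    bottom? : Decidable (EmbeddingAt P₁ members 0₁)
    bottom? = embeddingAt? P₁ members 0₁
    𝓑 𝓤 : Family n
    𝓑 = filterFamily bottom? 𝓜
    𝓤 = filterFamily (¬? ∘ bottom?) 𝓜
    regroup : ∀ d e f c → (d * f + 1) * c + (d * e + 1) * c ≡ (d * (e + f) + 2) * c
    regroup = solve-∀

    ∈𝓑⁻ : ∀ {A} → Mem 𝓑 A → A ∈ members × EmbeddingAt P₁ members 0₁ A
    ∈𝓑⁻ = ∈-filter⁻ bottom? {xs = members}
    ∈𝓤⁻ : ∀ {A} → Mem 𝓤 A → A ∈ members × ¬ EmbeddingAt P₁ members 0₁ A
    ∈𝓤⁻ = ∈-filter⁻ (¬? ∘ bottom?) {xs = members}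
    ∁∈𝓑 : ∀ {A} → Mem (complementFamily 𝓑) A → Mem 𝓑 (∁ A)
    ∁∈𝓑 A∈ with ∈-map⁻ ∁ A∈
    ... | B , B∈ , refl = subst (Mem 𝓑) (sym (∁-involutive B)) B∈

    -- A copy of P₁ inside 𝓤 is also one inside 𝓜, so its bottom would have been put into 𝓑.
    free₁ : ¬ Embedding P₁ (Mem 𝓤)
    free₁ f = proj₂ (∈𝓤⁻ (member f 0₁)) (restrict f (proj₁ ∘ ∈𝓤⁻ ∘ member f) , refl)

    -- Complements turn the copy of P₂ into one of its dual inside 𝓑. Its top is the bottom of a
    -- copy of P₁ whose other sets may be anywhere in 𝓜, and gluing the two gives a copy of P in 𝓜.
    free₂ : ¬ Embedding P₂ (Mem (complementFamily 𝓑))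
    free₂ g with ∈𝓑⁻ (∁∈𝓑 (member g 0₂))
    ... | _ , f , f0≡ = isFree⁻ free (glue-embedding⁺ P₁ P₂ 0₁-min 0₂-min f
          (dual-embedding⁺ {P₂} g (λ y → proj₁ (∈𝓑⁻ (∁∈𝓑 (member g y))))) f0≡)

    small₁ : ∀ A → Mem 𝓤 A → 4 * ∣ A ∣ < 3 * n
    small₁ A A∈ = proj₂ (middle A (proj₁ (∈𝓤⁻ A∈)))

    -- The lower cut-off n/4 enters here: on complements it becomes the upper cut-off 3n/4.
    small₂ : ∀ A → Mem (complementFamily 𝓑) A → 4 * ∣ A ∣ < 3 * n
    small₂ A A∈ = +-cancelʳ-< (4 * ∣ ∁ A ∣) _ _ (begin-strict
      4 * ∣ A ∣ + 4 * ∣ ∁ A ∣   ≡⟨ *-distribˡ-+ 4 ∣ A ∣ ∣ ∁ A ∣ ⟨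
      4 * (∣ A ∣ + ∣ ∁ A ∣)     ≡⟨ cong (4 *_) (∣A∣+∣∁A∣≡n A) ⟩
      4 * n                     ≡⟨ +-comm n (3 * n) ⟩
      3 * n + n                 <⟨ +-monoʳ-< (3 * n) (proj₁ (middle (∁ A) (proj₁ (∈𝓑⁻ (∁∈𝓑 A∈))))) ⟩
      3 * n + 4 * ∣ ∁ A ∣       ∎)

  free-size≤ : (𝓕 : Family n) → P IsFree Mem 𝓕 → d * size 𝓕 ≤ (d * (e₁ + e₂) + 4) * centre n
  free-size≤ 𝓕 free = begin
    d * size 𝓕
      ≡⟨ cong (d *_) (trans (length-filter-¬ large? (Family.members 𝓕)) (cong (λ k → size 𝓛 + k) (length-filter-¬ small? (Family.members 𝓡)))) ⟩
    d * (size 𝓛 + (size 𝓢 + size 𝓜))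
      ≡⟨ regroup₁ d (size 𝓛) (size 𝓢) (size 𝓜) ⟩
    d * size 𝓛 + d * size 𝓢 + d * size 𝓜
      ≤⟨ +-mono-≤ (+-mono-≤
           (large-sets-negligible d n 400d≤n _ (Family.unique 𝓛) (proj₂ ∘ ∈-filter⁻ large? {xs = Family.members 𝓕}))
           (small-sets-negligible d n 400d≤n _ (Family.unique 𝓢) (proj₂ ∘ ∈-filter⁻ small? {xs = Family.members 𝓡})))
           (middle-size≤ 𝓜 (isFree⁺ {P} λ f → isFree⁻ free (restrict f (𝓜⊆𝓕 ∘ member f))) middle) ⟩
    -- One central coefficient for each tail and one for each of the two Lubell bounds: this is the
    -- 4.
    centre n + centre n + (d * (e₁ + e₂) + 2) * centre n
      ≡⟨ regroup₂ (d * (e₁ + e₂)) (centre n) ⟩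
    (d * (e₁ + e₂) + 4) * centre n ∎
    where
    open ≤-Reasoning
    large? : Decidable λ (A : Subset n) → 3 * n ≤ 4 * ∣ A ∣
    large? A = 3 * n ≤? 4 * ∣ A ∣
    small? : Decidable λ (A : Subset n) → 4 * ∣ A ∣ ≤ n
    small? A = 4 * ∣ A ∣ ≤? n
    𝓛 𝓡 𝓢 𝓜 : Family n
    𝓛 = filterFamily large? 𝓕
    𝓡 = filterFamily (¬? ∘ large?) 𝓕
    𝓢 = filterFamily small? 𝓡
    𝓜 = filterFamily (¬? ∘ small?) 𝓡
    regroup₁ : ∀ d l s m → d * (l + (s + m)) ≡ d * l + d * s + d * m
    regroup₁ = solve-∀
    regroup₂ : ∀ x c → c + c + (x + 2) * c ≡ (x + 4) * c
    regroup₂ = solve-∀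
    ∈𝓡⁻ : ∀ {A} → Mem 𝓡 A → Mem 𝓕 A × ¬ 3 * n ≤ 4 * ∣ A ∣
    ∈𝓡⁻ = ∈-filter⁻ (¬? ∘ large?) {xs = Family.members 𝓕}
    ∈𝓜⁻ : ∀ {A} → Mem 𝓜 A → Mem 𝓡 A × ¬ 4 * ∣ A ∣ ≤ n
    ∈𝓜⁻ = ∈-filter⁻ (¬? ∘ small?) {xs = Family.members 𝓡}
    𝓜⊆𝓕 : ∀ {A} → Mem 𝓜 A → Mem 𝓕 A
    𝓜⊆𝓕 = proj₁ ∘ ∈𝓡⁻ ∘ proj₁ ∘ ∈𝓜⁻
    middle : ∀ A → Mem 𝓜 A → n < 4 * ∣ A ∣ × 4 * ∣ A ∣ < 3 * n
    middle A A∈ = ≰⇒> (proj₂ (∈𝓜⁻ A∈)) , ≰⇒> (proj₂ (∈𝓡⁻ (proj₁ (∈𝓜⁻ A∈))))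

  La-upper : ∀ {m} → IsLa P n m → d * m ≤ (d * (e₁ + e₂) + 4) * centre n
  La-upper ((𝓕 , free , refl) , _) = free-size≤ 𝓕 free

-- The e levels from the middle upwards are P-free and lose at most e³/(h + 1) central coefficients.
-- For n ≥ 2de³ one has h + 1 ≥ de³, so d times that loss is at most one.
La-lower : ∀ {P e m} d n → (∀ n s → P IsFree Levels n s e) → IsLa P n m → 2 * (d * (e * (e * e))) ≤ n →
           d * (e * centre n) ≤ d * m + centre n
La-lower {P} {e} {m} d n free (_ , maximal) 2de³≤n = *-cancelˡ-≤ (suc h) (begin
  suc h * (d * (e * centre n))
    ≡⟨ regroup₁ h d (e * centre n) ⟩
  d * (suc h * (e * centre n))
    ≤⟨ *-monoʳ-≤ d (length-layers n e) ⟩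
  d * (suc h * l + e * (e * e) * centre n)
    ≡⟨ regroup₂ h d l (e * (e * e)) (centre n) ⟩
  suc h * (d * l) + d * (e * (e * e)) * centre n
    ≤⟨ +-mono-≤ (*-monoʳ-≤ (suc h) (*-monoʳ-≤ d l≤m)) (*-monoˡ-≤ (centre n) de³≤1+h) ⟩
  suc h * (d * m) + suc h * centre n
    ≡⟨ *-distribˡ-+ (suc h) (d * m) (centre n) ⟨
  suc h * (d * m + centre n) ∎)
  where
  open ≤-Reasoning
  h l : ℕ
  h = ⌊ n /2⌋
  l = length (layers n h e)
  regroup₁ : ∀ h d x → suc h * (d * x) ≡ d * (suc h * x)
  regroup₁ = solve-∀
  regroup₂ : ∀ h d l x c → d * (suc h * l + x * c) ≡ suc h * (d * l) + d * x * c
  regroup₂ = solve-∀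
  l≤m : l ≤ m
  l≤m = maximal l (record { members = layers n h e ; unique = layers-unique n h e } ,
    isFree⁺ {P} (λ f → isFree⁻ (free n (+ h)) (restrict f λ x →
      let lo , hi = ∈-layers⁻ n h e (member f x) in ℤ.+≤+ lo , ℤ.+<+ hi)) , refl)
  de³≤1+h : d * (e * (e * e)) ≤ suc h
  de³≤1+h = *-cancelˡ-≤ 2 (begin
    2 * (d * (e * (e * e)))  ≤⟨ 2de³≤n ⟩
    n                        ≤⟨ n≤1+2*⌊n/2⌋ n ⟩
    1 + 2 * h                ≤⟨ n≤1+n _ ⟩
    2 + 2 * h                ≡⟨ *-suc 2 h ⟨
    2 * suc h                ∎)

theorem7p3 : (P₁ P₂ : FinitePoset) →
    {0₁ : FinitePoset.Carrier P₁} (0₁-min : Minimum (FinitePoset._≤_ P₁) 0₁) →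
    {0₂ : FinitePoset.Carrier P₂} (0₂-min : Minimum (FinitePoset._≤_ P₂) 0₂) →
    LowerLBounded P₁ → LowerLBounded P₂ →
    let P = glue P₁ (dual P₂) 0₁-min 0₂-min in
    ∃[ e ] IsE P e × IsPi P (fromℕ e)
theorem7p3 P₁ P₂ 0₁-min 0₂-min L₁@(e₁ , isE₁ , _) L₂@(e₂ , isE₂ , _) =
  e , isE , (proj₁ ∘ La-exists P) , (proj₂ ∘ La-exists P) , converges
  where
  P : FinitePoset
  P = glue P₁ (dual P₂) 0₁-min 0₂-min
  e : ℕ
  e = e₁ + e₂
  isE : IsE P e
  isE = isE-glue P₁ P₂ 0₁-min 0₂-min isE₁ isE₂

  converges : (λ n → (+ proj₁ (La-exists P n) / centre n) {{centre-nonZero n}}) ConvergesTo fromℕ e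
  converges ε 0<ε = N , λ n N≤n → ∣/-fromℕ∣<ε (La n) (centre n) e ε {{centre-nonZero n}} 0<ε (upper n N≤n) (lower n N≤n)
    where
    La : ℕ → ℕ
    La n = proj₁ (La-exists P n)
    d N₁ N₂ N : ℕ
    d = 5 * ↧ₙ ε
    N₁ = proj₁ (lubellBound {P₁} L₁ d)
    N₂ = proj₁ (lubellBound {P₂} L₂ d)
    -- The thresholds are those of the two Lubell bounds, of the tails, and of the loss in the
    -- levels near the middle.
    N = N₁ ⊔ N₂ ⊔ (400 * d) ⊔ (2 * (d * (e * (e * e))))
    upper : ∀ n → N ≤ n → d * La n ≤ (d * e + 4) * centre n
    upper n N≤n = La-upper P₁ P₂ 0₁-min 0₂-min {e₁} {e₂} d n
      (m⊔n≤o⇒n≤o (N₁ ⊔ N₂) _ N₃≤n)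
      (proj₂ (lubellBound {P₁} L₁ d) n (m⊔n≤o⇒m≤o N₁ _ (m⊔n≤o⇒m≤o (N₁ ⊔ N₂) _ N₃≤n)))
      (proj₂ (lubellBound {P₂} L₂ d) n (m⊔n≤o⇒n≤o N₁ _ (m⊔n≤o⇒m≤o (N₁ ⊔ N₂) _ N₃≤n)))
      (proj₂ (La-exists P n))
      where
      N₃≤n : N₁ ⊔ N₂ ⊔ (400 * d) ≤ n
      N₃≤n = m⊔n≤o⇒m≤o _ (2 * (d * (e * (e * e)))) N≤n
    lower : ∀ n → N ≤ n → d * (e * centre n) ≤ d * La n + 4 * centre n
    lower n N≤n = ≤-trans
      (La-lower {P} {e} d n (proj₁ isE) (proj₂ (La-exists P n)) (m⊔n≤o⇒n≤o (N₁ ⊔ N₂ ⊔ (400 * d)) _ N≤n))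
      -- This side costs a single error unit, enlarged to four to match the upper side.
      (+-monoʳ-≤ (d * La n) (m≤n*m (centre n) 4))
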